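{- Let $C$ be a weakly skew circuit of size $t$ and formal degree $d$. There is a depth four circuit $\Gamma$ computing the same polynomial as $C$ with at most $(t+1)^2+1$ unweighted addition gates and at most $2(t+1)^{\sqrt{3d}+2}$ multiplication gates. There is a depth four arithmetic formula $\Gamma_f$ computing the same polynomial with at most $(t+1)^{\sqrt{3d}}+1$ unweighted addition gates and at most $2(t+1)^{2\sqrt{3d}}$ multiplication gates. The inputs of $\Gamma$ and $\Gamma_f$ are inputs of $C$ or constants, and their multiplication gates have fan-in at most $\sqrt{3d}+1$. If $C$ is constant-free and all the addition gates of $C$ are ordinary additions or subtractions, then these constants are integers of absolute value at most $2^t$.
   Context: An arithmetic circuit has input gates labelled by variables or field constants (each of fan-out at most 1), multiplication gates, and addition gates, which may be weighted (computing $\sum a_ix_i$ from inputs $x_i$ with weights $a_i$); ordinary addition and subtraction gates are binary with weights $(1,1)$ and $(1,-1)$. Constant-free means the only constants are from $\{ -1,0,1\}$. Size is the number of gates including inputs. Formal degree: 1 for inputs, max of inputs' formal degrees for addition gates, sum for multiplication gates; the circuit's formal degree is that of its output. A circuit with binary multiplication gates is weakly skew if for every multiplication gate $\alpha$, at least one of its two input gates $\beta$ has the property that the subcircuit computing $\beta$ is connected to the rest of the circuit only through the edge from $\beta$ to $\alpha$. A depth four circuit is a $\Sigma\Pi\Sigma\Pi$ circuit with gates of unbounded fan-in (output addition gate, then multiplication gates, then addition gates, then multiplication gates fed by input gates). An unweighted addition gate computes the sum of its inputs. A depth four formula is a depth four circuit where every non-output gate has fan-out one. -}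

module Defs where

open import Level using (Level; _⊔_) renaming (suc to lsuc)
open import Data.Nat using (ℕ; zero; suc; _+_; _*_; _∸_; _^_; _≤_; _<_) renaming (_⊔_ to _⊔ℕ_)
open import Data.Nat using () renaming (_≟_ to _≟ℕ_)
open import Data.Fin using (Fin; toℕ)
open import Data.Product using (Σ; ∃; ∃-syntax; _×_; _,_; proj₁; proj₂)
open import Data.Sum using (_⊎_)
open import Data.List using (List; []; _∷_; _++_; map; length; filter; foldr)
open import Data.List.Membership.Propositional using (_∈_)
open import Data.List.Relation.Unary.All using (All)
open import Data.Vec using (Vec; lookup; _∷ʳ_) renaming ([] to []v)
open import Relation.Binary.PropositionalEquality using (_≡_; _≢_)
open import Relation.Nullary using (¬_)
open import Algebra.Bundles using (CommutativeRing)

record Field (c ℓ : Level) : Set (lsuc (c ⊔ ℓ)) where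
  field
    commutativeRing : CommutativeRing c ℓ
  private module R = CommutativeRing commutativeRing
  field
    0≉1     : ¬ (R._≈_ R.0# R.1#)
    inverse : ∀ x → ¬ (R._≈_ x R.0#) → ∃[ y ] (R._≈_ (R._*_ x y) R.1#)

module _ {c ℓ : Level} (F : Field c ℓ) where
  open Field F using (commutativeRing)
  open CommutativeRing commutativeRing
    using (_≈_; 0#; 1#) renaming (Carrier to K; _+_ to _+K_; _*_ to _*K_; -_ to -K_)

  -- Polynomials K[x₀, x₁, …]: terms modulo the least congruence making
  -- them a commutative semiring in which constants compute as in K.
  -- (This quotient is exactly the free commutative K-algebra K[X].)

  data Expr : Set c where
    var : ℕ → Expr
    con : K → Expr
    _⊕_ : Expr → Expr → Expr
    _⊗_ : Expr → Expr → Expr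

  infix 4 _≋_
  data _≋_ : Expr → Expr → Set (c ⊔ ℓ) where
    ≋-refl   : ∀ {p} → p ≋ p
    ≋-sym    : ∀ {p q} → p ≋ q → q ≋ p
    ≋-trans  : ∀ {p q r} → p ≋ q → q ≋ r → p ≋ r
    ⊕-cong   : ∀ {p p' q q'} → p ≋ p' → q ≋ q' → (p ⊕ q) ≋ (p' ⊕ q')
    ⊗-cong   : ∀ {p p' q q'} → p ≋ p' → q ≋ q' → (p ⊗ q) ≋ (p' ⊗ q')
    ⊕-assoc  : ∀ p q r → ((p ⊕ q) ⊕ r) ≋ (p ⊕ (q ⊕ r))
    ⊕-comm   : ∀ p q → (p ⊕ q) ≋ (q ⊕ p)
    ⊕-idˡ    : ∀ p → (con 0# ⊕ p) ≋ p
    ⊗-assoc  : ∀ p q r → ((p ⊗ q) ⊗ r) ≋ (p ⊗ (q ⊗ r))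
    ⊗-comm   : ∀ p q → (p ⊗ q) ≋ (q ⊗ p)
    ⊗-idˡ    : ∀ p → (con 1# ⊗ p) ≋ p
    ⊗-zeroˡ  : ∀ p → (con 0# ⊗ p) ≋ con 0#
    distribˡ : ∀ p q r → (p ⊗ (q ⊕ r)) ≋ ((p ⊗ q) ⊕ (p ⊗ r))
    con-≈    : ∀ {a b} → a ≈ b → con a ≋ con b
    con-+    : ∀ a b → (con a ⊕ con b) ≋ con (a +K b)
    con-*    : ∀ a b → (con a ⊗ con b) ≋ con (a *K b)

  -- Arithmetic circuits.  A circuit with n gates is a list of gates
  -- numbered 0 … n-1; gate number k may only take inputs from gates
  -- with smaller numbers (so the graph is acyclic).  The output is the
  -- last gate.  Input lists are lists of edges (with multiplicity).

  data Gate (k : ℕ) : Set c where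
    var : ℕ → Gate k
    cst : K → Gate k
    mul : List (Fin k) → Gate k
    add : List (K × Fin k) → Gate k

  infixl 5 _▷_
  data Circuit : ℕ → Set c where
    ∅   : Circuit 0
    _▷_ : ∀ {k} → Circuit k → Gate k → Circuit (suc k)

  data Kind : Set where
    inputK mulK addK : Kind

  kind : ∀ {k} → Gate k → Kind
  kind (var _) = inputK
  kind (cst _) = inputK
  kind (mul _) = mulK
  kind (add _) = addK

  inputs : ∀ {k} → Gate k → List ℕ
  inputs (var _)  = []
  inputs (cst _)  = []
  inputs (mul js) = map toℕ js
  inputs (add ws) = map (λ w → toℕ (proj₂ w)) ws

  data GateAt : ∀ {n} → Circuit n → (k : ℕ) → Gate k → Set c where
    here  : ∀ {k} {C : Circuit k} {g : Gate k} → GateAt (C ▷ g) k g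
    there : ∀ {k} {C : Circuit k} {g : Gate k} {i} {h : Gate i} →
            GateAt C i h → GateAt (C ▷ g) i h

  edges : ∀ {n} → Circuit n → List (ℕ × ℕ)
  edges ∅ = []
  edges (_▷_ {k} C g) = edges C ++ map (λ u → (u , k)) (inputs g)

  fanout : ∀ {n} → Circuit n → ℕ → ℕ
  fanout C i = length (filter (λ e → proj₁ e ≟ℕ i) (edges C))

  WellFormed : ∀ {n} → Circuit n → Set c
  WellFormed C = ∀ k (g : Gate k) → GateAt C k g → kind g ≡ inputK → fanout C k ≤ 1

  size : ∀ {n} → Circuit n → ℕ
  size {n} _ = n

  countMul : ∀ {n} → Circuit n → ℕ
  countMul ∅ = 0
  countMul (C ▷ mul _) = suc (countMul C)
  countMul (C ▷ _)     = countMul C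

  countAdd : ∀ {n} → Circuit n → ℕ
  countAdd ∅ = 0
  countAdd (C ▷ add _) = suc (countAdd C)
  countAdd (C ▷ _)     = countAdd C

  evalGate : ∀ {k} → Gate k → Vec Expr k → Expr
  evalGate (var x)  vs = var x
  evalGate (cst a)  vs = con a
  evalGate (mul js) vs = foldr (λ j acc → lookup vs j ⊗ acc) (con 1#) js
  evalGate (add ws) vs = foldr (λ w acc → (con (proj₁ w) ⊗ lookup vs (proj₂ w)) ⊕ acc) (con 0#) ws

  values : ∀ {n} → Circuit n → Vec Expr n
  values ∅       = []v
  values (C ▷ g) = values C ∷ʳ evalGate g (values C)

  output : ∀ {m} → Circuit (suc m) → Expr
  output (C ▷ g) = evalGate g (values C)

  fdegGate : ∀ {k} → Gate k → Vec ℕ k → ℕ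
  fdegGate (var _)  ds = 1
  fdegGate (cst _)  ds = 1
  fdegGate (mul js) ds = foldr (λ j acc → lookup ds j + acc) 0 js
  fdegGate (add ws) ds = foldr (λ w acc → lookup ds (proj₂ w) ⊔ℕ acc) 0 ws

  fdegs : ∀ {n} → Circuit n → Vec ℕ n
  fdegs ∅       = []v
  fdegs (C ▷ g) = fdegs C ∷ʳ fdegGate g (fdegs C)

  formalDegree : ∀ {m} → Circuit (suc m) → ℕ
  formalDegree (C ▷ g) = fdegGate g (fdegs C)

  data Reach {n} (C : Circuit n) : ℕ → ℕ → Set c where
    reach-refl : ∀ {u} → Reach C u u
    reach-step : ∀ {u v w} → (u , v) ∈ edges C → Reach C v w → Reach C u w

  -- the subcircuit computing β is connected to the rest of the circuit
  -- only through a single edge leaving β (namely the edge β → α)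
  Isolated : ∀ {n} → Circuit n → ℕ → Set c
  Isolated C β =
    fanout C β ≡ 1 ×
    (∀ u v → (u , v) ∈ edges C → Reach C u β → u ≢ β → Reach C v β)

  WeaklySkew : ∀ {n} → Circuit n → Set c
  WeaklySkew C = ∀ k (js : List (Fin k)) → GateAt C k (mul js) →
    ∃[ β ] ∃[ γ ] (js ≡ β ∷ γ ∷ [] × (Isolated C (toℕ β) ⊎ Isolated C (toℕ γ)))

  layerKind : ℕ → Kind
  layerKind 0 = inputK
  layerKind 1 = mulK
  layerKind 2 = addK
  layerKind 3 = mulK
  layerKind _ = addK

  IsDepthFour : ∀ {m} → Circuit (suc m) → Set c
  IsDepthFour {m} C = Σ (ℕ → ℕ) λ layer →
    layer m ≡ 4 ×
    (∀ k (g : Gate k) → GateAt C k g → layer k ≤ 4 × kind g ≡ layerKind (layer k)) ×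
    (∀ k (g : Gate k) → GateAt C k g → layer k ≡ 4 → k ≡ m) ×
    (∀ u v → (u , v) ∈ edges C → suc (layer u) ≡ layer v)

  IsFormula : ∀ {m} → Circuit (suc m) → Set c
  IsFormula {m} C = ∀ k (g : Gate k) → GateAt C k g → k ≢ m → fanout C k ≡ 1

  UnweightedAdds : ∀ {n} → Circuit n → Set (c ⊔ ℓ)
  UnweightedAdds C = ∀ k ws → GateAt C k (add ws) → All (λ w → proj₁ w ≈ 1#) ws

  -- every multiplication gate has fan-in f with f ≤ √m + 1,
  -- i.e. (f ∸ 1)² ≤ m
  MulFanInBound : ∀ {n} → Circuit n → ℕ → Set c
  MulFanInBound C m = ∀ k js → GateAt C k (mul js) → (length js ∸ 1) ^ 2 ≤ m

  InputsFrom : ∀ {n n'} → Circuit n → Circuit n' → Set c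
  InputsFrom Γ C = ∀ k x → GateAt Γ k (var x) → ∃[ k' ] GateAt C k' (var x)

  ConstantFree : ∀ {n} → Circuit n → Set (c ⊔ ℓ)
  ConstantFree C = ∀ k a → GateAt C k (cst a) → a ≈ 0# ⊎ a ≈ 1# ⊎ a ≈ -K 1#

  OrdinaryAdds : ∀ {n} → Circuit n → Set (c ⊔ ℓ)
  OrdinaryAdds C = ∀ k ws → GateAt C k (add ws) →
    ∃[ w₁ ] ∃[ w₂ ] ∃[ i ] ∃[ j ]
      (ws ≡ (w₁ , i) ∷ (w₂ , j) ∷ [] × w₁ ≈ 1# × (w₂ ≈ 1# ⊎ w₂ ≈ -K 1#))

  ι : ℕ → K
  ι zero    = 0#
  ι (suc n) = 1# +K ι n

  SmallIntConstants : ∀ {n} → Circuit n → ℕ → Set (c ⊔ ℓ)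
  SmallIntConstants Γ t = ∀ k a → GateAt Γ k (cst a) →
    ∃[ z ] (z ≤ 2 ^ t × (a ≈ ι z ⊎ a ≈ -K ι z))

-- Bounds with irrational exponents, expressed in ℕ.
-- PowBound b a s e m N  means  N ≤ b · a^(s·√m + e)  (as real numbers),
-- for a ≥ 1.  Since x ↦ a^x is continuous and nondecreasing, this holds
-- iff N ≤ b·a^(s·r + e) for every rational r = p/q ≥ √m, i.e. iff
-- N^q ≤ b^q · a^(s·p + e·q) whenever q > 0 and m·q² ≤ p².
PowBound : (b a s e m N : ℕ) → Set
PowBound b a s e m N =
  ∀ p q → 0 < q → m * (q * q) ≤ p * p → N ^ q ≤ b ^ q * a ^ (s * p + e * q)

module _ {c ℓ : Level} (F : Field c ℓ) where
  Depth4Simulation : ∀ {m n} → Circuit F (suc m) → Circuit F (suc n) → Set (c ⊔ ℓ)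
  Depth4Simulation {m} C Γ =
    WellFormed F Γ ×
    IsDepthFour F Γ ×
    UnweightedAdds F Γ ×
    _≋_ F (output F Γ) (output F C) ×
    MulFanInBound F Γ (3 * formalDegree F C) ×
    InputsFrom F Γ C ×
    (ConstantFree F C → OrdinaryAdds F C → SmallIntConstants F Γ (suc m))

{-# OPTIONS --safe #-}

-- Following Malod and Portier, a weakly skew circuit is unfolded into a branching
-- program with one vertex per gate and a source.  If u lies in the isolated factor γ of
-- a product β γ, a walk must have computed β before entering the subcircuit of γ, so an
-- input gate u receives an edge, labelled by that input, from the partner β of the
-- innermost isolated factor containing u (or from the source).  All other edges carry
-- constants, and walks of constant edges are contracted into single edges.  A walk then
-- alternates input edges and constant edges, and the formal degree d bounds the number
-- of input edges, so its length is at most 2d.  With a = ⌊√(3d)⌋, cutting the walks into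
-- a blocks of 2⌈a/2⌉ ≤ a + 1 edges writes the output as a sum of products of a block
-- sums, each block sum being a sum of products of inputs: this is the depth four circuit.

module Submission where

open import Defs
open import Level using (Level; _⊔_)
open import Function using (_∘_)
open import Data.Bool using (true; false; if_then_else_)
open import Data.Empty using (⊥)
open import Data.Fin as Fin using (Fin; toℕ; fromℕ<)
open import Data.Fin.Properties using (toℕ<n; toℕ-fromℕ<; fromℕ<-injective; injective⇒≤)
open import Data.List using (List; []; _∷_; _++_; map; length; filter; foldr; concatMap; upTo; replicate; cartesianProduct; lookup)
open import Data.List.Membership.Propositional using (_∈_; _∉_; find)
open import Data.List.Membership.Propositional.Properties using (∈-++⁺ˡ; ∈-++⁺ʳ; ∈-++⁻; ∈-map⁺; ∈-map⁻; ∈-filter⁺; ∈-filter⁻; ∈-upTo⁺; ∈-lookup; ∈-cartesianProduct⁺; ∈-cartesianProduct⁻)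
open import Data.List.Properties using (length-++; length-map; length-replicate; length-upTo; filter-++; filter-accept; filter-reject; filter-none; ∷-injectiveʳ; map-∘)
open import Data.List.Relation.Binary.Pointwise using (Pointwise; []; _∷_; Pointwise-length)
open import Data.List.Relation.Unary.All as All using (All; []; _∷_)
import Data.List.Relation.Unary.All.Properties as All
open import Data.List.Relation.Unary.AllPairs using (AllPairs; []; _∷_)
import Data.List.Relation.Unary.AllPairs.Properties as AllPairs
open import Data.List.Relation.Unary.Any as Any using (here; there)
open import Data.List.Relation.Unary.Unique.Propositional using (Unique)
import Data.List.Relation.Unary.Unique.Propositional.Properties as Unique
open import Data.Nat using (ℕ; zero; suc; _+_; _*_; _∸_; _^_; _≤_; _<_; _≟_; _≤?_; _<?_; z≤n; s≤s; NonZero) renaming (_⊔_ to _⊔ℕ_)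
open import Data.Nat.Induction using (<-rec)
open import Data.Nat.Properties
open import Data.Nat.Tactic.RingSolver using (solve-∀)
open import Data.Product using (Σ; ∃-syntax; _×_; _,_; proj₁; proj₂)
open import Data.Sum using (_⊎_; inj₁; inj₂)
open import Data.Unit using (⊤; tt)
open import Data.Vec as Vec using (Vec; _∷ʳ_)
open import Relation.Binary.Bundles using (Setoid)
open import Relation.Binary.PropositionalEquality using (_≡_; _≢_; refl; sym; trans; cong; cong₂; subst; module ≡-Reasoning)
import Relation.Binary.Reasoning.Setoid as SetoidReasoning
open import Relation.Nullary using (¬_; Dec; yes; no; does; contradiction)
open import Relation.Nullary.Decidable using (dec-true; dec-false)
open import Relation.Unary using (Pred; Decidable)
open import Algebra.Bundles using (CommutativeRing)
import Algebra.Properties.Ring as RingProperties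

-- Sums and products of polynomials, and sums over walks

-- Only input edges use up degree. Since isolated subcircuits that meet are nested, the products in
-- whose isolated factor a gate lies form a stack, innermost on top. The walks from the source to a
-- gate sum to its value times the values of the partners of all products on its stack, and the
-- formal degree of this polynomial bounds their number of input edges. A loop of weight one at the
-- source lets short walks wait there, so a fixed number of rounds (an input edge, then a constant
-- edge) is enough. The constant 3 is rounding slack: d rounds have 2d edges, so about √(2d) blocks
-- of √(2d) edges would do, but blocks must consist of whole rounds and both numbers must be
-- integers. The circuit and the formula expand the same sum; they differ only in whether a block
-- sum is built once for each pair of vertices or once for each occurrence. The delicate invariant
-- is fan-out: at most one for input gates in both, exactly one for every gate below the output in
-- the formula. So the construction, gate by gate, keeps an exact account of fan-outs.

length-concatMap-const : ∀ {a b} {A : Set a} {B : Set b} {f : A → List B} {k} xs →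
  (∀ x → length (f x) ≡ k) → length (concatMap f xs) ≡ length xs * k
length-concatMap-const         []       h = refl
length-concatMap-const {f = f} (x ∷ xs) h =
  trans (length-++ (f x)) (cong₂ _+_ (h x) (length-concatMap-const xs h))

module _ {e} {E : Set e} (V : List ℕ) where
  -- All pairs of vertices count as edges, absent ones being labelled by zero. A walk is then just a
  -- choice of inner vertices, which makes the number of walks uniform.
  walks : (A : ℕ → ℕ → E) (As : List (ℕ → ℕ → E)) → ℕ → ℕ → List (List E)
  walks A []       u v = (A u v ∷ []) ∷ []
  walks A (B ∷ As) u v = concatMap (λ w → map (A u w ∷_) (walks B As w v)) V

  length-walks : ∀ A As u v → length (walks A As u v) ≡ length V ^ length As
  length-walks A []       u v = refl
  length-walks A (B ∷ As) u v = length-concatMap-const V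
    λ w → trans (length-map (A u w ∷_) (walks B As w v)) (length-walks B As w v)

  All-walks : ∀ {p} {P : E → Set p} A As →
    All (λ B → ∀ {u v} → u ∈ V → v ∈ V → P (B u v)) (A ∷ As) →
    ∀ {u v} → u ∈ V → v ∈ V → All (λ ms → length ms ≡ suc (length As) × All P ms) (walks A As u v)
  All-walks A []       (a ∷ _)  u∈ v∈ = (refl , a u∈ v∈ ∷ []) ∷ []
  All-walks A (B ∷ As) (a ∷ as) u∈ v∈ = All.concat⁺ (All.map⁺ (All.tabulate λ w∈ →
    All.map⁺ (All.map (λ (eq , ps) → cong suc eq , a u∈ w∈ ∷ ps) (All-walks B As as w∈ v∈))))

module _ {c ℓ : Level} (F : Field c ℓ) where
  open Field F using (commutativeRing)
  open CommutativeRing commutativeRing using (0#; 1#)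

  Polynomial : Set c
  Polynomial = Expr F

  ≋-setoid : Setoid c (c ⊔ ℓ)
  ≋-setoid = record
    { Carrier = Polynomial ; _≈_ = _≋_ F
    ; isEquivalence = record { refl = ≋-refl ; sym = ≋-sym ; trans = ≋-trans } }

  open SetoidReasoning ≋-setoid

  ≡⇒≋ : ∀ {p q} → p ≡ q → _≋_ F p q
  ≡⇒≋ refl = ≋-refl

  ⊕-idʳ : ∀ p → _≋_ F (p ⊕ con 0#) p
  ⊕-idʳ p = ≋-trans (⊕-comm p _) (⊕-idˡ p)

  ⊗-idʳ : ∀ p → _≋_ F (p ⊗ con 1#) p
  ⊗-idʳ p = ≋-trans (⊗-comm p _) (⊗-idˡ p)

  ⊗-zeroʳ : ∀ p → _≋_ F (p ⊗ con 0#) (con 0#)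
  ⊗-zeroʳ p = ≋-trans (⊗-comm p _) (⊗-zeroˡ p)

  distribʳ : ∀ p q r → _≋_ F ((q ⊕ r) ⊗ p) ((q ⊗ p) ⊕ (r ⊗ p))
  distribʳ p q r = ≋-trans (⊗-comm _ p)
    (≋-trans (distribˡ p q r) (⊕-cong (⊗-comm p q) (⊗-comm p r)))

  ⊕-interchange : ∀ p q r s → _≋_ F ((p ⊕ q) ⊕ (r ⊕ s)) ((p ⊕ r) ⊕ (q ⊕ s))
  ⊕-interchange p q r s = begin
    (p ⊕ q) ⊕ (r ⊕ s)   ≈⟨ ⊕-assoc p q (r ⊕ s) ⟩
    p ⊕ (q ⊕ (r ⊕ s))   ≈⟨ ⊕-cong ≋-refl (⊕-assoc q r s) ⟨
    p ⊕ ((q ⊕ r) ⊕ s)   ≈⟨ ⊕-cong ≋-refl (⊕-cong (⊕-comm q r) ≋-refl) ⟩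
    p ⊕ ((r ⊕ q) ⊕ s)   ≈⟨ ⊕-cong ≋-refl (⊕-assoc r q s) ⟩
    p ⊕ (r ⊕ (q ⊕ s))   ≈⟨ ⊕-assoc p r (q ⊕ s) ⟨
    (p ⊕ r) ⊕ (q ⊕ s)   ∎

  ⊗-swapˡ : ∀ p q r → _≋_ F (p ⊗ (q ⊗ r)) (q ⊗ (p ⊗ r))
  ⊗-swapˡ p q r = begin
    p ⊗ (q ⊗ r)  ≈⟨ ⊗-assoc p q r ⟨
    (p ⊗ q) ⊗ r  ≈⟨ ⊗-cong (⊗-comm p q) ≋-refl ⟩
    (q ⊗ p) ⊗ r  ≈⟨ ⊗-assoc q p r ⟩
    q ⊗ (p ⊗ r)  ∎

  module _ {a} {A : Set a} where
    ∑ ∏ : List A → (A → Polynomial) → Polynomial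
    ∑ xs f = foldr (λ x acc → f x ⊕ acc) (con 0#) xs
    ∏ xs f = foldr (λ x acc → f x ⊗ acc) (con 1#) xs

    ∑-cong-∈ : ∀ xs {f g : A → Polynomial} → (∀ {x} → x ∈ xs → _≋_ F (f x) (g x)) → _≋_ F (∑ xs f) (∑ xs g)
    ∑-cong-∈ []       h = ≋-refl
    ∑-cong-∈ (x ∷ xs) h = ⊕-cong (h (here refl)) (∑-cong-∈ xs (h ∘ there))

    ∑-cong : ∀ xs {f g : A → Polynomial} → (∀ x → _≋_ F (f x) (g x)) → _≋_ F (∑ xs f) (∑ xs g)
    ∑-cong xs h = ∑-cong-∈ xs (λ {x} _ → h x)

    ∑-zero-∈ : ∀ xs {f : A → Polynomial} → (∀ {x} → x ∈ xs → _≋_ F (f x) (con 0#)) → _≋_ F (∑ xs f) (con 0#)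
    ∑-zero-∈ []       h = ≋-refl
    ∑-zero-∈ (x ∷ xs) h = ≋-trans (⊕-cong (h (here refl)) (∑-zero-∈ xs (h ∘ there))) (⊕-idˡ _)

    ∑-⊕ : ∀ xs (f g : A → Polynomial) → _≋_ F (∑ xs (λ x → f x ⊕ g x)) (∑ xs f ⊕ ∑ xs g)
    ∑-⊕ []       f g = ≋-sym (⊕-idˡ _)
    ∑-⊕ (x ∷ xs) f g = ≋-trans (⊕-cong ≋-refl (∑-⊕ xs f g)) (⊕-interchange _ _ _ _)

    ⊗-∑ : ∀ p xs (f : A → Polynomial) → _≋_ F (p ⊗ ∑ xs f) (∑ xs (λ x → p ⊗ f x))
    ⊗-∑ p []       f = ⊗-zeroʳ p
    ⊗-∑ p (x ∷ xs) f = ≋-trans (distribˡ _ _ _) (⊕-cong ≋-refl (⊗-∑ p xs f))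

    ∑-⊗ : ∀ p xs (f : A → Polynomial) → _≋_ F (∑ xs f ⊗ p) (∑ xs (λ x → f x ⊗ p))
    ∑-⊗ p []       f = ⊗-zeroˡ p
    ∑-⊗ p (x ∷ xs) f = ≋-trans (distribʳ _ _ _) (⊕-cong ≋-refl (∑-⊗ p xs f))

    ∑-++ : ∀ xs ys (f : A → Polynomial) → _≋_ F (∑ (xs ++ ys) f) (∑ xs f ⊕ ∑ ys f)
    ∑-++ []       ys f = ≋-sym (⊕-idˡ _)
    ∑-++ (x ∷ xs) ys f = ≋-trans (⊕-cong ≋-refl (∑-++ xs ys f)) (≋-sym (⊕-assoc _ _ _))

    ∑-single : ∀ {j xs} {f : A → Polynomial} → Unique xs → j ∈ xs →
      (∀ {x} → x ≢ j → _≋_ F (f x) (con 0#)) → _≋_ F (∑ xs f) (f j)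
    ∑-single {xs = x ∷ xs} {f} (x∉ ∷ _) (here refl) h =
      ≋-trans (⊕-cong ≋-refl (∑-zero-∈ xs λ y∈ → h (All.lookup x∉ y∈ ∘ sym))) (⊕-idʳ _)
    ∑-single (x∉ ∷ u) (there j∈) h =
      ≋-trans (⊕-cong (h (All.lookup x∉ j∈)) (∑-single u j∈ h)) (⊕-idˡ _)

  module _ {a b} {A : Set a} {B : Set b} where
    ∑-map : ∀ (g : A → B) xs f → ∑ (map g xs) f ≡ ∑ xs (f ∘ g)
    ∑-map g []       f = refl
    ∑-map g (x ∷ xs) f = cong (f (g x) ⊕_) (∑-map g xs f)

    ∏-map : ∀ (g : A → B) xs f → ∏ (map g xs) f ≡ ∏ xs (f ∘ g)
    ∏-map g []       f = refl
    ∏-map g (x ∷ xs) f = cong (f (g x) ⊗_) (∏-map g xs f)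

    ∑-concatMap : ∀ (g : A → List B) xs f → _≋_ F (∑ (concatMap g xs) f) (∑ xs (λ x → ∑ (g x) f))
    ∑-concatMap g []       f = ≋-refl
    ∑-concatMap g (x ∷ xs) f = ≋-trans (∑-++ (g x) _ f) (⊕-cong ≋-refl (∑-concatMap g xs f))

    ∑-swap : ∀ (xs : List A) (ys : List B) (f : A → B → Polynomial) →
      _≋_ F (∑ xs (λ x → ∑ ys (f x))) (∑ ys (λ y → ∑ xs (λ x → f x y)))
    ∑-swap []       ys f = ≋-sym (∑-zero-∈ ys (λ _ → ≋-refl))
    ∑-swap (x ∷ xs) ys f = ≋-trans (⊕-cong ≋-refl (∑-swap xs ys f)) (≋-sym (∑-⊕ ys _ _))

  sumOfProducts : ∀ {e} {E : Set e} → (E → Polynomial) → List (List E) → Polynomial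
  sumOfProducts ⟦_⟧ mss = ∑ mss (λ ms → ∏ ms ⟦_⟧)

  module _ {e} {E : Set e} (⟦_⟧ : E → Polynomial) (V : List ℕ) where
    -- Multiplication of the row vector `y` by the matrix of labels `A`.
    act : (ℕ → Polynomial) → (ℕ → ℕ → E) → ℕ → Polynomial
    act y A v = ∑ V (λ u → y u ⊗ ⟦ A u v ⟧)

    acts : (ℕ → Polynomial) → (ℕ → ℕ → E) → List (ℕ → ℕ → E) → ℕ → Polynomial
    acts y A []       = act y A
    acts y A (B ∷ As) = acts (act y A) B As

    sumOfProducts-walks : ∀ A B As u v → _≋_ F (sumOfProducts ⟦_⟧ (walks V A (B ∷ As) u v))
      (∑ V (λ w → ⟦ A u w ⟧ ⊗ sumOfProducts ⟦_⟧ (walks V B As w v)))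
    sumOfProducts-walks A B As u v = ≋-trans (∑-concatMap _ V _) (∑-cong V λ w →
      ≋-trans (≡⇒≋ (∑-map (A u w ∷_) (walks V B As w v) _)) (≋-sym (⊗-∑ _ (walks V B As w v) _)))

    -- A vector multiplied by a chain of matrices, expanded by distributivity. It serves on both
    -- levels: with inputs as labels inside a block, and with blocks as labels at the top.
    ∑-⊗-walks : ∀ y A As v →
      _≋_ F (∑ V (λ u → y u ⊗ sumOfProducts ⟦_⟧ (walks V A As u v))) (acts y A As v)
    ∑-⊗-walks y A []       v = ∑-cong V λ u →
      ⊗-cong ≋-refl (≋-trans (⊕-idʳ _) (⊗-idʳ _))
    ∑-⊗-walks y A (B ∷ As) v = begin
      ∑ V (λ u → y u ⊗ sumOfProducts ⟦_⟧ (walks V A (B ∷ As) u v))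
        ≈⟨ ∑-cong V (λ u → ⊗-cong ≋-refl (sumOfProducts-walks A B As u v)) ⟩
      ∑ V (λ u → y u ⊗ ∑ V (λ w → ⟦ A u w ⟧ ⊗ Z w))
        ≈⟨ ∑-cong V (λ u → ≋-trans (⊗-∑ _ V _) (∑-cong V λ w → ≋-sym (⊗-assoc _ _ _))) ⟩
      ∑ V (λ u → ∑ V (λ w → (y u ⊗ ⟦ A u w ⟧) ⊗ Z w))
        ≈⟨ ∑-swap V V _ ⟩
      ∑ V (λ w → ∑ V (λ u → (y u ⊗ ⟦ A u w ⟧) ⊗ Z w))
        ≈⟨ ∑-cong V (λ w → ≋-sym (∑-⊗ (Z w) V _)) ⟩
      ∑ V (λ w → act y A w ⊗ Z w)
        ≈⟨ ∑-⊗-walks (act y A) B As v ⟩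
      acts (act y A) B As v ∎
      where
      Z : ℕ → Polynomial
      Z w = sumOfProducts ⟦_⟧ (walks V B As w v)

-- Circuits as functions on gate numbers

module _ {a} {A : Set a} (d : A) where
  -- Total, with a default out of range, so that gate numbers remain plain naturals while gates are
  -- appended.
  nth : ∀ {n} → Vec A n → ℕ → A
  nth Vec.[]       i       = d
  nth (x Vec.∷ xs) zero    = x
  nth (x Vec.∷ xs) (suc i) = nth xs i

  lookup≡nth : ∀ {n} (xs : Vec A n) j → Vec.lookup xs j ≡ nth xs (toℕ j)
  lookup≡nth (x Vec.∷ xs) Fin.zero    = refl
  lookup≡nth (x Vec.∷ xs) (Fin.suc j) = lookup≡nth xs j

  nth-∷ʳ-last : ∀ {n} (xs : Vec A n) x → nth (xs ∷ʳ x) n ≡ x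
  nth-∷ʳ-last Vec.[]       x = refl
  nth-∷ʳ-last (_ Vec.∷ xs) x = nth-∷ʳ-last xs x

  nth-∷ʳ-< : ∀ {n i} (xs : Vec A n) x → i < n → nth (xs ∷ʳ x) i ≡ nth xs i
  nth-∷ʳ-< {i = zero}  (_ Vec.∷ xs) x _         = refl
  nth-∷ʳ-< {i = suc i} (_ Vec.∷ xs) x (s≤s i<n) = nth-∷ʳ-< xs x i<n

count : ℕ → List ℕ → ℕ
count i js = length (filter (_≟ i) js)

count-++ : ∀ i xs ys → count i (xs ++ ys) ≡ count i xs + count i ys
count-++ i xs ys = trans (cong length (filter-++ (_≟ i) xs ys)) (length-++ (filter (_≟ i) xs))

-- The indicator of i < k, in the form in which appending gate k changes it.
below : ℕ → ℕ → ℕ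
below i zero    = 0
below i (suc k) = below i k + count i (k ∷ [])

count-self : ∀ i → count i (i ∷ []) ≡ 1
count-self i = cong length (filter-accept (_≟ i) {i} {[]} refl)

count-other : ∀ {i k} → k ≢ i → count i (k ∷ []) ≡ 0
count-other {i} {k} k≢i = cong length (filter-reject (_≟ i) {k} {[]} k≢i)

below-≥ : ∀ {i k} → k ≤ i → below i k ≡ 0
below-≥ {i} {zero}  k≤i = refl
below-≥ {i} {suc k} k<i = cong₂ _+_ (below-≥ (<⇒≤ k<i)) (count-other (<⇒≢ k<i))

below-< : ∀ {i k} → i < k → below i k ≡ 1
below-< {i} {suc k} i<1+k with m≤n⇒m<n∨m≡n i<1+k
... | inj₁ (s≤s i<k) = cong₂ _+_ (below-< i<k) (count-other (<⇒≢ i<k ∘ sym))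
... | inj₂ refl      = cong₂ _+_ (below-≥ {i} ≤-refl) (count-self i)

below≤1 : ∀ i k → below i k ≤ 1
below≤1 i k with <-≤-connex i k
... | inj₁ i<k = ≤-reflexive (below-< i<k)
... | inj₂ k≤i = ≤-trans (≤-reflexive (below-≥ k≤i)) z≤n

map-toℕ-fins : ∀ {k js} (js<k : All (_< k) js) → map toℕ (All.reduce (λ j<k → fromℕ< j<k) js<k) ≡ js
map-toℕ-fins []         = refl
map-toℕ-fins (j<k ∷ ps) = cong₂ _∷_ (toℕ-fromℕ< j<k) (map-toℕ-fins ps)

module _ {a} {A : Set a} (_•_ : A → A → A) (e : A) {b} {B : Set b} where
  foldr-cong : ∀ {f g : B → A} (xs : List B) → (∀ x → f x ≡ g x) →
    foldr (λ x acc → f x • acc) e xs ≡ foldr (λ x acc → g x • acc) e xs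
  foldr-cong []       h = refl
  foldr-cong (x ∷ xs) h = cong₂ _•_ (h x) (foldr-cong xs h)

length-filter-edges : ∀ i k us →
  length (filter (λ (e : ℕ × ℕ) → proj₁ e ≟ i) (map (λ u → (u , k)) us)) ≡ count i us
length-filter-edges i k []       = refl
length-filter-edges i k (u ∷ us) with does (u ≟ i)
... | true  = cong suc (length-filter-edges i k us)
... | false = length-filter-edges i k us

module _ {c ℓ : Level} (F : Field c ℓ) where
  open Field F using (commutativeRing)
  open CommutativeRing commutativeRing using (_≈_; 0#; 1#) renaming (Carrier to K; refl to ≈-refl)

  GateAt-< : ∀ {n k} {C : Circuit F n} {g} → GateAt F C k g → k < n
  GateAt-< here      = ≤-refl
  GateAt-< (there p) = m<n⇒m<1+n (GateAt-< p)

  findGate : ∀ {n k} (C : Circuit F n) → k < n → ∃[ g ] GateAt F C k g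
  findGate {k = k} (_▷_ {n} C g) k<1+n with m≤n⇒m<n∨m≡n k<1+n
  ... | inj₁ (s≤s k<n) = let h , p = findGate C k<n in h , there p
  ... | inj₂ refl      = g , here

  edge⇒gate : ∀ {n u v} (C : Circuit F n) → (u , v) ∈ edges F C →
    ∃[ g ] (GateAt F C v g × u ∈ inputs F g)
  edge⇒gate (C ▷ g) e with ∈-++⁻ (edges F C) e
  ... | inj₁ e' = let h , p , u∈ = edge⇒gate C e' in h , there p , u∈
  ... | inj₂ e' with ∈-map⁻ _ e'
  ... | _ , u∈ , refl = g , here , u∈

  gate⇒edge : ∀ {n u v} {C : Circuit F n} {g} → GateAt F C v g → u ∈ inputs F g → (u , v) ∈ edges F C
  gate⇒edge {C = C ▷ _} here      u∈ = ∈-++⁺ʳ (edges F C) (∈-map⁺ _ u∈)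
  gate⇒edge             (there p) u∈ = ∈-++⁺ˡ (gate⇒edge p u∈)

  inputs< : ∀ {k} (g : Gate F k) → All (_< k) (inputs F g)
  inputs< (var _)  = []
  inputs< (cst _)  = []
  inputs< (mul js) = All.map⁺ (All.universal toℕ<n js)
  inputs< (add ws) = All.map⁺ (All.universal (toℕ<n ∘ proj₂) ws)

  edge-< : ∀ {n u v} (C : Circuit F n) → (u , v) ∈ edges F C → u < v × v < n
  edge-< C e = let g , p , u∈ = edge⇒gate C e in All.lookup (inputs< g) u∈ , GateAt-< p

  fanout-▷ : ∀ {k} (C : Circuit F k) g i → fanout F (C ▷ g) i ≡ fanout F C i + count i (inputs F g)
  fanout-▷ {k} C g i = begin
    fanout F (C ▷ g) i
      ≡⟨ cong length (filter-++ _ (edges F C) _) ⟩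
    length (filter _ (edges F C) ++ filter _ (map (_, k) (inputs F g)))
      ≡⟨ length-++ (filter (λ e → proj₁ e ≟ i) (edges F C)) ⟩
    fanout F C i + length (filter _ (map (_, k) (inputs F g)))
      ≡⟨ cong (fanout F C i +_) (length-filter-edges i k (inputs F g)) ⟩
    fanout F C i + count i (inputs F g) ∎
    where open ≡-Reasoning

  -- Polynomials and formal degrees are tabulated by the same recursion. Appending gates never
  -- changes earlier entries, so in the finished table each gate satisfies its own equation.
  module Table {a} {A : Set a} (d : A)
    (step : ∀ {k} → Gate F k → Vec A k → A) (stepOn : ∀ {k} → Gate F k → (ℕ → A) → A)
    (step≡stepOn : ∀ {k} (g : Gate F k) xs → step g xs ≡ stepOn g (nth d xs))
    (stepOn-cong : ∀ {k} (g : Gate F k) {v w} → (∀ {i} → i < k → v i ≡ w i) → stepOn g v ≡ stepOn g w)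
    (table : ∀ {n} → Circuit F n → Vec A n)
    (table-▷ : ∀ {k} (C : Circuit F k) g → table (C ▷ g) ≡ table C ∷ʳ step g (table C))
    where

    at : ∀ {n} → Circuit F n → ℕ → A
    at C = nth d (table C)

    at-▷-< : ∀ {k i} (C : Circuit F k) g → i < k → at (C ▷ g) i ≡ at C i
    at-▷-< {i = i} C g i<k = trans (cong (λ xs → nth d xs i) (table-▷ C g)) (nth-∷ʳ-< d (table C) _ i<k)

    at-▷-last : ∀ {k} (C : Circuit F k) g → at (C ▷ g) k ≡ step g (table C)
    at-▷-last {k} C g = trans (cong (λ xs → nth d xs k) (table-▷ C g)) (nth-∷ʳ-last d (table C) _)

    at-▷ : ∀ {k} (C : Circuit F k) g → at (C ▷ g) k ≡ stepOn g (at C)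
    at-▷ C g = trans (at-▷-last C g) (step≡stepOn g (table C))

    at-GateAt : ∀ {n k} {C : Circuit F n} {g} → GateAt F C k g → at C k ≡ stepOn g (at C)
    at-GateAt {C = C ▷ g} here =
      trans (at-▷ C g) (stepOn-cong g λ i<k → sym (at-▷-< C g i<k))
    at-GateAt {C = C ▷ g} (there {h = h} p) =
      trans (at-▷-< C g (GateAt-< p)) (trans (at-GateAt p)
        (stepOn-cong h λ i<k → sym (at-▷-< C g (<-trans i<k (GateAt-< p)))))

  evalOn : ∀ {k} → Gate F k → (ℕ → Expr F) → Expr F
  evalOn (var x)  v = var x
  evalOn (cst a)  v = con a
  evalOn (mul js) v = ∏ F js (v ∘ toℕ)
  evalOn (add ws) v = ∑ F ws (λ (w , j) → con w ⊗ v (toℕ j))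

  degreeOn : ∀ {k} → Gate F k → (ℕ → ℕ) → ℕ
  degreeOn (var _)  v = 1
  degreeOn (cst _)  v = 1
  degreeOn (mul js) v = foldr (λ j acc → v (toℕ j) + acc) 0 js
  degreeOn (add ws) v = foldr (λ w acc → v (toℕ (proj₂ w)) ⊔ℕ acc) 0 ws

  evalGate≡evalOn : ∀ {k} (g : Gate F k) xs → evalGate F g xs ≡ evalOn g (nth (con 0#) xs)
  evalGate≡evalOn (var _)  xs = refl
  evalGate≡evalOn (cst _)  xs = refl
  evalGate≡evalOn (mul js) xs = foldr-cong _⊗_ _ js (lookup≡nth _ xs)
  evalGate≡evalOn (add ws) xs = foldr-cong _⊕_ _ ws λ (w , j) → cong (con w ⊗_) (lookup≡nth _ xs j)

  evalOn-cong : ∀ {k} (g : Gate F k) {v w} → (∀ {i} → i < k → v i ≡ w i) → evalOn g v ≡ evalOn g w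
  evalOn-cong (var _)  h = refl
  evalOn-cong (cst _)  h = refl
  evalOn-cong (mul js) h = foldr-cong _⊗_ _ js λ j → h (toℕ<n j)
  evalOn-cong (add ws) h = foldr-cong _⊕_ _ ws λ (w , j) → cong (con w ⊗_) (h (toℕ<n j))

  fdegGate≡degreeOn : ∀ {k} (g : Gate F k) xs → fdegGate F g xs ≡ degreeOn g (nth 0 xs)
  fdegGate≡degreeOn (var _)  xs = refl
  fdegGate≡degreeOn (cst _)  xs = refl
  fdegGate≡degreeOn (mul js) xs = foldr-cong _+_ _ js (lookup≡nth _ xs)
  fdegGate≡degreeOn (add ws) xs = foldr-cong _⊔ℕ_ _ ws (lookup≡nth _ xs ∘ proj₂)

  degreeOn-cong : ∀ {k} (g : Gate F k) {v w} → (∀ {i} → i < k → v i ≡ w i) → degreeOn g v ≡ degreeOn g w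
  degreeOn-cong (var _)  h = refl
  degreeOn-cong (cst _)  h = refl
  degreeOn-cong (mul js) h = foldr-cong _+_ _ js λ j → h (toℕ<n j)
  degreeOn-cong (add ws) h = foldr-cong _⊔ℕ_ _ ws λ (w , j) → h (toℕ<n j)

  module Value  = Table (con 0#) (evalGate F) evalOn evalGate≡evalOn evalOn-cong (values F) (λ _ _ → refl)
  module Degree = Table 0 (fdegGate F) degreeOn fdegGate≡degreeOn degreeOn-cong (fdegs F) (λ _ _ → refl)

  value : ∀ {n} → Circuit F n → ℕ → Expr F
  value = Value.at

  degree : ∀ {n} → Circuit F n → ℕ → ℕ
  degree = Degree.at

  output≡value : ∀ {m} (C : Circuit F (suc m)) → output F C ≡ value C m
  output≡value (C ▷ g) = sym (Value.at-▷-last C g)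

  formalDegree≡degree : ∀ {m} (C : Circuit F (suc m)) → formalDegree F C ≡ degree C m
  formalDegree≡degree (C ▷ g) = sym (Degree.at-▷-last C g)

  data Input : Set c where
    indeterminate : ℕ → Input
    constant  : K → Input

  inputGate : ∀ {k} → Input → Gate F k
  inputGate (indeterminate x) = var x
  inputGate (constant a)  = cst a

  ⟦_⟧ᵢ : Input → Expr F
  ⟦ indeterminate x ⟧ᵢ = var x
  ⟦ constant a ⟧ᵢ  = con a

  fins : ∀ {k js} → All (_< k) js → List (Fin k)
  fins = All.reduce (λ j<k → fromℕ< j<k)

  mulGate addGate : ∀ {k js} → All (_< k) js → Gate F k
  mulGate ps = mul (fins ps)
  addGate ps = add (map (1# ,_) (fins ps))

  evalOn-mulGate : ∀ {k js} (ps : All (_< k) js) v → evalOn (mulGate ps) v ≡ ∏ F js v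
  evalOn-mulGate ps v = trans (sym (∏-map F toℕ (fins ps) v)) (cong (λ js → ∏ F js v) (map-toℕ-fins ps))

  evalOn-addGate : ∀ {k js} (ps : All (_< k) js) v → _≋_ F (evalOn (addGate ps) v) (∑ F js v)
  evalOn-addGate {js = js} ps v = ≋-trans (≡⇒≋ F (∑-map F (1# ,_) (fins ps) _))
    (≋-trans (∑-cong F (fins ps) (λ j → ⊗-idˡ _))
      (≡⇒≋ F (trans (sym (∑-map F toℕ (fins ps) v)) (cong (λ js → ∑ F js v) (map-toℕ-fins ps)))))

  inputs-addGate : ∀ {k js} (ps : All (_< k) js) → inputs F (addGate ps) ≡ js
  inputs-addGate ps = trans (sym (map-∘ (fins ps))) (map-toℕ-fins ps)

  length-fins : ∀ {k js} (ps : All (_< k) js) → length (fins ps) ≡ length js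
  length-fins ps = trans (sym (length-map toℕ (fins ps))) (cong length (map-toℕ-fins ps))

  addGate-unweighted : ∀ {k js} (ps : All (_< k) js) → All (λ w → proj₁ w ≈ 1#) (map (1# ,_) (fins ps))
  addGate-unweighted ps = All.map⁺ (All.universal (λ _ → ≈-refl) (fins ps))

  isMul isAdd : ∀ {k} → Gate F k → ℕ
  isMul (mul _) = 1
  isMul _       = 0
  isAdd (add _) = 1
  isAdd _       = 0

  countMul-▷ : ∀ {k} (C : Circuit F k) g → countMul F (C ▷ g) ≡ countMul F C + isMul g
  countMul-▷ C (var _) = sym (+-identityʳ _)
  countMul-▷ C (cst _) = sym (+-identityʳ _)
  countMul-▷ C (mul _) = +-comm 1 _
  countMul-▷ C (add _) = sym (+-identityʳ _)

  countAdd-▷ : ∀ {k} (C : Circuit F k) g → countAdd F (C ▷ g) ≡ countAdd F C + isAdd g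
  countAdd-▷ C (var _) = sym (+-identityʳ _)
  countAdd-▷ C (cst _) = sym (+-identityʳ _)
  countAdd-▷ C (mul _) = sym (+-identityʳ _)
  countAdd-▷ C (add _) = +-comm 1 _

-- Layered circuits, built one gate at a time

update : (ℕ → ℕ) → ℕ → ℕ → ℕ → ℕ
update f k x i = if does (i ≟ k) then x else f i

update-self : ∀ f k x → update f k x k ≡ x
update-self f k x = cong (if_then x else f k) (dec-true (k ≟ k) refl)

update-other : ∀ f {k} x {i} → i ≢ k → update f k x i ≡ f i
update-other f {k} x {i} i≢k = cong (if_then x else f i) (dec-false (i ≟ k) i≢k)

module _ {c ℓ : Level} (F : Field c ℓ) where
  open Field F using (commutativeRing)
  open CommutativeRing commutativeRing using (_≈_; 1#)

  module Builder {q} (M : ℕ) (Allowed : Input F → Set q) where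

    data GateOk {k} : Gate F k → Set (c ⊔ ℓ ⊔ q) where
      var-ok : ∀ {x} → Allowed (indeterminate x) → GateOk (var x)
      cst-ok : ∀ {a} → Allowed (constant a) → GateOk (cst a)
      mul-ok : ∀ {js} → (length js ∸ 1) ^ 2 ≤ M → GateOk (mul js)
      add-ok : ∀ {ws} → All (λ w → proj₁ w ≈ 1#) ws → GateOk (add ws)

    -- Layers stop at 3 during the construction: the only gate of layer 4 is the output, appended by
    -- `Finish`.
    record Layered {k} (C : Circuit F k) (layer : ℕ → ℕ) : Set (c ⊔ ℓ ⊔ q) where
      field
        gate-layer : ∀ i g → GateAt F C i g → layer i ≤ 3 × kind F g ≡ layerKind F (layer i)
        gate-ok    : ∀ i g → GateAt F C i g → GateOk g
        edge-layer : ∀ u v → (u , v) ∈ edges F C → suc (layer u) ≡ layer v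
    open Layered

    record State : Set (c ⊔ ℓ ⊔ q) where
      constructor state
      field
        {gateCount} : ℕ
        circuit : Circuit F gateCount
        layer   : ℕ → ℕ
        layered : Layered circuit layer
    open State

    -- Fan-outs are not among the preserved data, because later gates may use the old ones; `Built`
    -- keeps that account.
    record _⊑_ (S S′ : State) : Set c where
      field
        size≤  : gateCount S ≤ gateCount S′
        value≡ : ∀ {i} → i < gateCount S → value F (circuit S′) i ≡ value F (circuit S) i
        layer≡ : ∀ {i} → i < gateCount S → layer S′ i ≡ layer S i
    open _⊑_

    ⊑-refl : ∀ {S} → S ⊑ S
    ⊑-refl = record { size≤ = ≤-refl ; value≡ = λ _ → refl ; layer≡ = λ _ → refl }

    ⊑-trans : ∀ {S S′ S″} → S ⊑ S′ → S′ ⊑ S″ → S ⊑ S″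
    ⊑-trans p q = record
      { size≤  = ≤-trans (size≤ p) (size≤ q)
      ; value≡ = λ i< → trans (value≡ q (<-≤-trans i< (size≤ p))) (value≡ p i<)
      ; layer≡ = λ i< → trans (layer≡ q (<-≤-trans i< (size≤ p))) (layer≡ p i<) }

    push : ∀ (S : State) (g : Gate F (gateCount S)) L → L ≤ 3 → kind F g ≡ layerKind F L → GateOk g →
      All (λ r → suc (layer S r) ≡ L) (inputs F g) → State
    push S g L L≤3 kind≡ ok ins = state (circuit S ▷ g) layer′ (record
      { gate-layer = gl ; gate-ok = go ; edge-layer = el })
      where
      k = gateCount S
      layer′ = update (layer S) k L
      old : ∀ {i} → i < k → layer′ i ≡ layer S i
      old i<k = update-other (layer S) L (<⇒≢ i<k)
      gl : ∀ i h → GateAt F (circuit S ▷ g) i h → layer′ i ≤ 3 × kind F h ≡ layerKind F (layer′ i)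
      gl _ _ here rewrite update-self (layer S) k L = L≤3 , kind≡
      gl i h (there p) rewrite old (GateAt-< F p) = gate-layer (layered S) i h p
      go : ∀ i h → GateAt F (circuit S ▷ g) i h → GateOk h
      go _ _ here      = ok
      go i h (there p) = gate-ok (layered S) i h p
      el : ∀ u v → (u , v) ∈ edges F (circuit S ▷ g) → suc (layer′ u) ≡ layer′ v
      el u v e with ∈-++⁻ (edges F (circuit S)) e
      ... | inj₁ e′ = let u<v , v<k = edge-< F (circuit S) e′ in
        trans (cong suc (old (<-trans u<v v<k))) (trans (edge-layer (layered S) u v e′) (sym (old v<k)))
      ... | inj₂ e′ with ∈-map⁻ _ e′
      ... | _ , u∈ , refl = trans (cong suc (old (All.lookup (inputs< F g) u∈)))
        (trans (All.lookup ins u∈) (sym (update-self (layer S) k L)))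

    ⊑-push : ∀ S g L a b d e → S ⊑ push S g L a b d e
    ⊑-push S g L _ _ _ _ = record
      { size≤ = n≤1+n _ ; value≡ = Value.at-▷-< F (circuit S) g
      ; layer≡ = λ i<k → update-other (layer S) L (<⇒≢ i<k) }

    -- `fan`: once every root gets an outgoing edge, the new gates have fan-out one and
    -- the old ones keep theirs; only the gates outside Q may have been shared.
    record Built (S : State) (L : ℕ) (ps : List (Expr F)) (Q : ℕ → Set) (nm na : ℕ) : Set (c ⊔ ℓ ⊔ q) where
      field
        result      : State
        extends     : S ⊑ result
        roots       : List ℕ
        roots<      : All (_< gateCount result) roots
        roots-layer : All (λ r → layer result r ≡ L) roots
        roots-value : Pointwise (λ r p → _≋_ F (value F (circuit result) r) p) roots ps
        fan         : ∀ i → Q i → fanout F (circuit result) i + count i roots + below i (gateCount S)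
                          ≡ fanout F (circuit S) i + below i (gateCount result)
        muls        : countMul F (circuit result) ≡ countMul F (circuit S) + nm
        adds        : countAdd F (circuit result) ≡ countAdd F (circuit S) + na
    open Built

    -- A construction that runs on every extension of `Base`: plans can then be chained, and
    -- references to gates of `Base` survive whatever was built in between.
    record Plan (Base : State) (L : ℕ) (ps : List (Expr F)) (Q : ℕ → Set) (nm na : ℕ) : Set (c ⊔ ℓ ⊔ q) where
      constructor plan
      field run : ∀ S → Base ⊑ S → Built S L ps Q nm na
    open Plan

    -- Refers to existing gates instead of building new ones, which is how sharing enters. A gate
    -- reused here breaks its fan-out account, so `Q` has to exclude it.
    refsPlan : ∀ {Base L ps Q js} → All (_< gateCount Base) js → All (λ r → layer Base r ≡ L) js →
      Pointwise (λ r p → _≋_ F (value F (circuit Base) r) p) js ps → (∀ i → Q i → count i js ≡ 0) →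
      Plan Base L ps Q 0 0
    refsPlan {Base} {L} {js = js} js< jsL jsV unshared = plan λ S ext → record
      { result = S ; extends = ⊑-refl ; roots = js
      ; roots< = All.map (λ j< → <-≤-trans j< (size≤ ext)) js<
      ; roots-layer = All.zipWith (λ (j< , eq) → trans (layer≡ ext j<) eq) (js< , jsL)
      ; roots-value = vals ext js< jsV
      ; fan = λ i qi → cong (_+ below i (gateCount S))
          (trans (cong (fanout F (circuit S) i +_) (unshared i qi)) (+-identityʳ _))
      ; muls = sym (+-identityʳ _) ; adds = sym (+-identityʳ _) }
      where
      vals : ∀ {S js ps} → Base ⊑ S → All (_< gateCount Base) js →
        Pointwise (λ r p → _≋_ F (value F (circuit Base) r) p) js ps →
        Pointwise (λ r p → _≋_ F (value F (circuit S) r) p) js ps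
      vals ext []        []       = []
      vals ext (j< ∷ ps) (x ∷ xs) = ≋-trans (≡⇒≋ F (value≡ ext j<)) x ∷ vals ext ps xs

    nilPlan : ∀ {Base L Q} → Plan Base L [] Q 0 0
    nilPlan = refsPlan [] [] [] (λ _ _ → refl)

    Pointwise-++ : ∀ {S S′ rs ss ps qs} → S ⊑ S′ → All (_< gateCount S) rs →
      Pointwise (λ r p → _≋_ F (value F (circuit S) r) p) rs ps →
      Pointwise (λ r p → _≋_ F (value F (circuit S′) r) p) ss qs →
      Pointwise (λ r p → _≋_ F (value F (circuit S′) r) p) (rs ++ ss) (ps ++ qs)
    Pointwise-++ ext []        []       ys = ys
    Pointwise-++ ext (r< ∷ rs) (x ∷ xs) ys = ≋-trans (≡⇒≋ F (value≡ ext r<)) x ∷ Pointwise-++ ext rs xs ys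

    private
      -- The accounts of two consecutive stages are added, and the fan-out and size in between
      -- cancel.
      fan-++ : ∀ f₀ f₁ f₂ c₁ c₂ b₀ b₁ b₂ →
        f₁ + c₁ + b₀ ≡ f₀ + b₁ → f₂ + c₂ + b₁ ≡ f₁ + b₂ → f₂ + (c₁ + c₂) + b₀ ≡ f₀ + b₂
      fan-++ f₀ f₁ f₂ c₁ c₂ b₀ b₁ b₂ e₁ e₂ = +-cancelʳ-≡ (f₁ + b₁) _ _ (begin
        f₂ + (c₁ + c₂) + b₀ + (f₁ + b₁)   ≡⟨ lhs f₂ c₁ c₂ b₀ f₁ b₁ ⟩
        f₁ + c₁ + b₀ + (f₂ + c₂ + b₁)     ≡⟨ cong₂ _+_ e₁ e₂ ⟩
        f₀ + b₁ + (f₁ + b₂)               ≡⟨ rhs f₀ b₁ f₁ b₂ ⟩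
        f₀ + b₂ + (f₁ + b₁)               ∎)
        where
        open ≡-Reasoning
        lhs : ∀ f₂ c₁ c₂ b₀ f₁ b₁ → f₂ + (c₁ + c₂) + b₀ + (f₁ + b₁) ≡ f₁ + c₁ + b₀ + (f₂ + c₂ + b₁)
        lhs = solve-∀
        rhs : ∀ f₀ b₁ f₁ b₂ → f₀ + b₁ + (f₁ + b₂) ≡ f₀ + b₂ + (f₁ + b₁)
        rhs = solve-∀

      -- `x` indicates the new gate, which is both the only remaining root and the only growth of
      -- the circuit; the former roots, counted by `cr`, become its incoming edges.
      fan-push : ∀ f₀ f₁ cr b₀ b₁ x → f₁ + cr + b₀ ≡ f₀ + b₁ → f₁ + cr + x + b₀ ≡ f₀ + (b₁ + x)
      fan-push f₀ f₁ cr b₀ b₁ x e = trans (swap (f₁ + cr) x b₀) (trans (cong (_+ x) e) (+-assoc f₀ b₁ x))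
        where
        swap : ∀ a x b → a + x + b ≡ a + b + x
        swap = solve-∀

    _++ᵖ_ : ∀ {Base L ps qs Q nm nm′ na na′} → Plan Base L ps Q nm na → Plan Base L qs Q nm′ na′ →
      Plan Base L (ps ++ qs) Q (nm + nm′) (na + na′)
    _++ᵖ_ {Base} P Q = plan λ S ext → append S (run P S ext) (run Q _ (⊑-trans ext (extends (run P S ext))))
      where
      append : ∀ {L ps qs Q nm nm′ na na′} S (B : Built S L ps Q nm na) →
        Built (result B) L qs Q nm′ na′ → Built S L (ps ++ qs) Q (nm + nm′) (na + na′)
      append S B D = record
        { result = result D ; extends = ⊑-trans (extends B) (extends D) ; roots = roots B ++ roots D
        ; roots< = All.++⁺ (All.map (λ r< → <-≤-trans r< (size≤ (extends D))) (roots< B)) (roots< D)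
        ; roots-layer = All.++⁺ (All.zipWith (λ (r< , eq) → trans (layer≡ (extends D) r<) eq)
            (roots< B , roots-layer B)) (roots-layer D)
        ; roots-value = Pointwise-++ (extends D) (roots< B) (roots-value B) (roots-value D)
        ; fan = λ i qi → trans (cong (λ z → _ + z + below i (gateCount S)) (count-++ i (roots B) (roots D)))
            (fan-++ (fanout F (circuit S) i) (fanout F (circuit (result B)) i) _ (count i (roots B))
              (count i (roots D)) _ _ (below i (gateCount (result D))) (fan B i qi) (fan D i qi))
        ; muls = trans (muls D) (trans (cong (_+ _) (muls B)) (+-assoc (countMul F (circuit S)) _ _))
        ; adds = trans (adds D) (trans (cong (_+ _) (adds B)) (+-assoc (countAdd F (circuit S)) _ _)) }

    pushBuilt : ∀ {S L ps Q nm na p} L′ (B : Built S L ps Q nm na) (g : Gate F (gateCount (result B))) →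
      inputs F g ≡ roots B → L′ ≤ 3 → kind F g ≡ layerKind F L′ → GateOk g →
      All (λ r → suc (layer (result B) r) ≡ L′) (roots B) →
      _≋_ F (evalOn F g (value F (circuit (result B)))) p →
      Built S L′ (p ∷ []) Q (nm + isMul F g) (na + isAdd F g)
    pushBuilt {S} L′ B g refl L′≤3 kind≡ ok ins val = record
      { result = R′ ; extends = ⊑-trans (extends B) (⊑-push R g L′ L′≤3 kind≡ ok ins)
      ; roots = gateCount R ∷ [] ; roots< = ≤-refl ∷ []
      ; roots-layer = update-self (layer R) _ L′ ∷ []
      ; roots-value = ≋-trans (≡⇒≋ F (Value.at-▷ F (circuit R) g)) val ∷ []
      ; fan = λ i qi → trans (cong (λ z → z + count i (gateCount R ∷ []) + below i (gateCount S)) (fanout-▷ F (circuit R) g i))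
          (fan-push (fanout F (circuit S) i) (fanout F (circuit R) i) (count i (roots B)) (below i (gateCount S))
            (below i (gateCount R)) (count i (gateCount R ∷ [])) (fan B i qi))
      ; muls = trans (countMul-▷ F (circuit R) g) (trans (cong (_+ isMul F g) (muls B)) (+-assoc (countMul F (circuit S)) _ _))
      ; adds = trans (countAdd-▷ F (circuit R) g) (trans (cong (_+ isAdd F g) (adds B)) (+-assoc (countAdd F (circuit S)) _ _)) }
      where
      R = result B
      R′ = push R g L′ L′≤3 kind≡ ok ins

    ∑-Pointwise : ∀ {v : ℕ → Expr F} {rs ps} → Pointwise (λ r p → _≋_ F (v r) p) rs ps →
      _≋_ F (∑ F rs v) (∑ F ps (λ p → p))
    ∑-Pointwise []       = ≋-refl
    ∑-Pointwise (x ∷ xs) = ⊕-cong x (∑-Pointwise xs)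

    ∏-Pointwise : ∀ {v : ℕ → Expr F} {rs ps} → Pointwise (λ r p → _≋_ F (v r) p) rs ps →
      _≋_ F (∏ F rs v) (∏ F ps (λ p → p))
    ∏-Pointwise []       = ≋-refl
    ∏-Pointwise (x ∷ xs) = ⊗-cong x (∏-Pointwise xs)

    -- Every occurrence of an input receives a gate of its own, as well-formedness limits input
    -- gates to fan-out one.
    inputPlan : ∀ {Base Q} x → Allowed x → Plan Base 0 (⟦_⟧ᵢ F x ∷ []) Q 0 0
    inputPlan x ok = plan λ S ext → go x ok (run (nilPlan {L = 0}) S ext)
      where
      go : ∀ {S Q} x → Allowed x → Built S 0 [] Q 0 0 → Built S 0 (⟦_⟧ᵢ F x ∷ []) Q 0 0
      go x ok B with roots B in eq | roots-value B
      go (indeterminate x) ok B | [] | [] = pushBuilt 0 B (var x) (sym eq) z≤n refl (var-ok ok) (subst (All _) (sym eq) []) ≋-refl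
      go (constant a)  ok B | [] | [] = pushBuilt 0 B (cst a) (sym eq) z≤n refl (cst-ok ok) (subst (All _) (sym eq) []) ≋-refl

    mulPlan : ∀ {Base L ps Q nm na} → mulK ≡ layerKind F (suc L) → suc L ≤ 3 → (length ps ∸ 1) ^ 2 ≤ M →
      Plan Base L ps Q nm na → Plan Base (suc L) (∏ F ps (λ p → p) ∷ []) Q (nm + 1) (na + 0)
    mulPlan {L = L} kind≡ L<3 bound P = plan λ S ext → let B = run P S ext in
      pushBuilt (suc L) B (mulGate F (roots< B)) (map-toℕ-fins (roots< B)) L<3 kind≡
        (mul-ok (subst (λ z → (z ∸ 1) ^ 2 ≤ M)
          (sym (trans (length-fins F (roots< B)) (Pointwise-length (roots-value B)))) bound))
        (All.map (cong suc) (roots-layer B))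
        (≋-trans (≡⇒≋ F (evalOn-mulGate F (roots< B) _)) (∏-Pointwise (roots-value B)))

    addPlan : ∀ {Base L ps Q nm na} → addK ≡ layerKind F (suc L) → suc L ≤ 3 →
      Plan Base L ps Q nm na → Plan Base (suc L) (∑ F ps (λ p → p) ∷ []) Q (nm + 0) (na + 1)
    addPlan {L = L} kind≡ L<3 P = plan λ S ext → let B = run P S ext in
      pushBuilt (suc L) B (addGate F (roots< B)) (inputs-addGate F (roots< B)) L<3 kind≡
        (add-ok (addGate-unweighted F (roots< B)))
        (All.map (cong suc) (roots-layer B))
        (≋-trans (evalOn-addGate F (roots< B) _) (∑-Pointwise (roots-value B)))

    forestPlan : ∀ {a} {A : Set a} {Base L Q} (⟦_⟧ : A → Expr F) nm na (xs : List A) →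
      All (λ x → Plan Base L (⟦ x ⟧ ∷ []) Q nm na) xs →
      Plan Base L (map ⟦_⟧ xs) Q (length xs * nm) (length xs * na)
    forestPlan ⟦_⟧ nm na []       []       = nilPlan
    forestPlan ⟦_⟧ nm na (x ∷ xs) (p ∷ ps) = p ++ᵖ forestPlan ⟦_⟧ nm na xs ps

    replan : ∀ {Base L p p′ Q nm nm′ na na′} → p ≡ p′ → nm ≡ nm′ → na ≡ na′ →
      Plan Base L (p ∷ []) Q nm na → Plan Base L (p′ ∷ []) Q nm′ na′
    replan refl refl refl P = P

    monomialPlan : ∀ {Base Q} xs → (length xs ∸ 1) ^ 2 ≤ M → All Allowed xs →
      Plan Base 1 (∏ F xs (⟦_⟧ᵢ F) ∷ []) Q 1 0
    monomialPlan xs bound ok = replan (∏-map F (⟦_⟧ᵢ F) xs _)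
      (cong (_+ 1) (*-zeroʳ (length xs))) (trans (+-identityʳ _) (*-zeroʳ (length xs)))
      (mulPlan refl (s≤s z≤n) (subst (λ z → (z ∸ 1) ^ 2 ≤ M) (sym (length-map _ xs)) bound)
        (forestPlan (⟦_⟧ᵢ F) 0 0 xs (All.map (inputPlan _) ok)))

    blockPlan : ∀ {Base Q} xss → All (λ xs → (length xs ∸ 1) ^ 2 ≤ M × All Allowed xs) xss →
      Plan Base 2 (sumOfProducts F (⟦_⟧ᵢ F) xss ∷ []) Q (length xss) 1
    blockPlan xss ok = replan (∑-map F (λ xs → ∏ F xs (⟦_⟧ᵢ F)) xss _)
      (trans (+-identityʳ _) (*-identityʳ _)) (cong (_+ 1) (*-zeroʳ (length xss)))
      (addPlan refl (s≤s (s≤s z≤n))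
        (forestPlan (λ xs → ∏ F xs (⟦_⟧ᵢ F)) 1 0 xss (All.map (λ (b , ok) → monomialPlan _ b ok) ok)))

    emptyState : State
    emptyState = state ∅ (λ _ → 0) (record
      { gate-layer = λ _ _ () ; gate-ok = λ _ _ () ; edge-layer = λ _ _ () })

    module Finish (S : State) (rs : List ℕ) (rs< : All (_< gateCount S) rs) (rs-layer : All (λ r → layer S r ≡ 3) rs) where
      Γ : Circuit F (suc (gateCount S))
      Γ = circuit S ▷ addGate F rs<

      private
        m = gateCount S
        layer′ = update (layer S) m 4
        old : ∀ {i} → i < m → layer′ i ≡ layer S i
        old i<m = update-other (layer S) 4 (<⇒≢ i<m)

      output-Γ : _≋_ F (output F Γ) (∑ F rs (value F (circuit S)))
      output-Γ = ≋-trans (≡⇒≋ F (evalGate≡evalOn F (addGate F rs<) (values F (circuit S)))) (evalOn-addGate F rs< _)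

      fanout-Γ : ∀ i → fanout F Γ i ≡ fanout F (circuit S) i + count i rs
      fanout-Γ i = trans (fanout-▷ F (circuit S) (addGate F rs<) i)
        (cong (λ js → fanout F (circuit S) i + count i js) (inputs-addGate F rs<))

      depth-four : IsDepthFour F Γ
      depth-four = layer′ , update-self (layer S) m 4 , kinds , top , el
        where
        kinds : ∀ k g → GateAt F Γ k g → layer′ k ≤ 4 × kind F g ≡ layerKind F (layer′ k)
        kinds _ _ here rewrite update-self (layer S) m 4 = ≤-refl , refl
        kinds k g (there p) rewrite old (GateAt-< F p) =
          let l≤3 , eq = gate-layer (layered S) k g p in m≤n⇒m≤1+n l≤3 , eq
        top : ∀ k g → GateAt F Γ k g → layer′ k ≡ 4 → k ≡ m
        top _ _ here      eq = refl
        top k g (there p) eq rewrite old (GateAt-< F p) =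
          contradiction (proj₁ (gate-layer (layered S) k g p)) (<⇒≱ (≤-reflexive (sym eq)))
        el : ∀ u v → (u , v) ∈ edges F Γ → suc (layer′ u) ≡ layer′ v
        el u v e with ∈-++⁻ (edges F (circuit S)) e
        ... | inj₁ e′ = let u<v , v<k = edge-< F (circuit S) e′ in
          trans (cong suc (old (<-trans u<v v<k))) (trans (edge-layer (layered S) u v e′) (sym (old v<k)))
        ... | inj₂ e′ with ∈-map⁻ _ e′
        ... | _ , u∈ , refl with subst (u ∈_) (inputs-addGate F rs<) u∈
        ... | u∈′ = trans (cong suc (trans (old (All.lookup rs< u∈′)) (All.lookup rs-layer u∈′)))
          (sym (update-self (layer S) m 4))

      Γ-ok : ∀ k g → GateAt F Γ k g → GateOk g
      Γ-ok _ _ here      = add-ok (addGate-unweighted F rs<)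
      Γ-ok k g (there p) = gate-ok (layered S) k g p

      unweighted : UnweightedAdds F Γ
      unweighted k ws p with add-ok h ← Γ-ok k _ p = h

      mul-fan-in : MulFanInBound F Γ M
      mul-fan-in k js p with mul-ok h ← Γ-ok k _ p = h

      variables-allowed : ∀ k x → GateAt F Γ k (var x) → Allowed (indeterminate x)
      variables-allowed k x p with var-ok h ← Γ-ok k _ p = h

      constants-allowed : ∀ k a → GateAt F Γ k (cst a) → Allowed (constant a)
      constants-allowed k a p with cst-ok h ← Γ-ok k _ p = h

      well-formed : (∀ {i} → i < m → layer S i ≡ 0 → fanout F Γ i ≤ 1) → WellFormed F Γ
      well-formed h _ _ here      ()
      well-formed h k g (there p) eq =
        h (GateAt-< F p) (zero-layer (layer S k) (gate-layer (layered S) k g p))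
        where
        zero-layer : ∀ l → l ≤ 3 × kind F g ≡ layerKind F l → l ≡ 0
        zero-layer l (l≤3 , eq′) with trans (sym eq) eq′
        zero-layer 0 _ | _ = refl
        zero-layer 1 _ | ()
        zero-layer 2 _ | ()
        zero-layer 3 _ | ()
        zero-layer (suc (suc (suc (suc _)))) _ | ()

      is-formula : (∀ {i} → i < m → fanout F Γ i ≡ 1) → IsFormula F Γ
      is-formula h _ _ here      k≢m = contradiction refl k≢m
      is-formula h k g (there p) _   = h (GateAt-< F p)

-- Isolated subcircuits of a weakly skew circuit

module _ {a p q} {A : Set a} {P : Pred A p} {Q : Pred A q} (P? : Decidable P) (Q? : Decidable Q) where
  filter-cong-∈ : ∀ xs → (∀ {x} → x ∈ xs → P x → Q x) → (∀ {x} → x ∈ xs → Q x → P x) →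
    filter P? xs ≡ filter Q? xs
  filter-cong-∈ []       f g = refl
  filter-cong-∈ (x ∷ xs) f g with P? x
  ... | yes px = trans (cong (x ∷_) (filter-cong-∈ xs (f ∘ there) (g ∘ there)))
                       (sym (filter-accept Q? (f (here refl) px)))
  ... | no ¬px = trans (filter-cong-∈ xs (f ∘ there) (g ∘ there))
                       (sym (filter-reject Q? (¬px ∘ g (here refl))))

module _ {p q} {P : Pred ℕ p} {Q : Pred ℕ q} (P? : Decidable P) (Q? : Decidable Q) where
  -- `xs` is sorted and `P` holds only above `m`, so the one additional element comes out at the
  -- head.
  filter-insert : ∀ {m xs} → AllPairs _<_ xs → m ∈ xs → Q m → (∀ {x} → P x → m < x) →
    (∀ {x} → x ∈ xs → P x → Q x) → (∀ {x} → x ∈ xs → Q x → x ≡ m ⊎ P x) →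
    filter Q? xs ≡ m ∷ filter P? xs
  filter-insert {m} {.m ∷ xs} (x< ∷ _) (here refl) qm m< f g =
    trans (filter-accept Q? qm) (cong (m ∷_) (trans
      (filter-cong-∈ Q? P? xs to (f ∘ there)) (sym (filter-reject P? (<-irrefl refl ∘ m<)))))
    where
    to : ∀ {x} → x ∈ xs → Q x → P x
    to x∈ qx with g (there x∈) qx
    ... | inj₁ refl = contradiction (All.lookup x< x∈) (<-irrefl refl)
    ... | inj₂ px   = px
  filter-insert {m} {x ∷ xs} (x< ∷ xs<) (there m∈) qm m< f g =
    trans (filter-reject Q? ¬qx) (trans (filter-insert xs< m∈ qm m< (f ∘ there) (g ∘ there))
      (cong (m ∷_) (sym (filter-reject P? ¬px))))
    where
    ¬px : ¬ P x
    ¬px px = <-asym (m< px) (All.lookup x< m∈)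
    ¬qx : ¬ Q x
    ¬qx qx with g (here refl) qx
    ... | inj₁ refl = <-irrefl refl (All.lookup x< m∈)
    ... | inj₂ px   = ¬px px

Unique-lookup-injective : ∀ {a} {A : Set a} {xs : List A} → Unique xs → ∀ i j → lookup xs i ≡ lookup xs j → i ≡ j
Unique-lookup-injective (x∉ ∷ u) Fin.zero    Fin.zero    eq = refl
Unique-lookup-injective (x∉ ∷ u) Fin.zero    (Fin.suc j) eq = contradiction eq (All.lookup x∉ (∈-lookup j))
Unique-lookup-injective (x∉ ∷ u) (Fin.suc i) Fin.zero    eq = contradiction (sym eq) (All.lookup x∉ (∈-lookup i))
Unique-lookup-injective (x∉ ∷ u) (Fin.suc i) (Fin.suc j) eq = cong Fin.suc (Unique-lookup-injective u i j eq)

Unique⇒length≤ : ∀ {n xs} → Unique xs → All (_< n) xs → length xs ≤ n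
Unique⇒length≤ {n} {xs} u xs< = injective⇒≤ {f = f} λ {i} {j} eq →
  Unique-lookup-injective u i j (fromℕ<-injective _ _ _ _ eq)
  where
  f : Fin (length xs) → Fin n
  f i = fromℕ< (All.lookup xs< (∈-lookup {xs = xs} i))

upTo-sorted : ∀ n → AllPairs _<_ (upTo n)
upTo-sorted n = AllPairs.applyUpTo⁺₁ (λ i → i) n (λ i<j _ → i<j)

module _ {c ℓ : Level} (F : Field c ℓ) where
  open Field F using (commutativeRing)
  open CommutativeRing commutativeRing using () renaming (Carrier to K)

  count≤fanout : ∀ {n k} {C : Circuit F n} {g} i → GateAt F C k g → count i (inputs F g) ≤ fanout F C i
  count≤fanout {C = C ▷ g} i here      = ≤-trans (m≤n+m _ _) (≤-reflexive (sym (fanout-▷ F C g i)))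
  count≤fanout {C = C ▷ g} i (there p) = ≤-trans (count≤fanout i p)
    (≤-trans (m≤m+n _ _) (≤-reflexive (sym (fanout-▷ F C g i))))

  fanout≡1⇒unique : ∀ {n u v w} (C : Circuit F n) → fanout F C u ≡ 1 →
    (u , v) ∈ edges F C → (u , w) ∈ edges F C → v ≡ w
  fanout≡1⇒unique {u = u} C one e₁ e₂
    with filter (λ e → proj₁ e ≟ u) (edges F C)
       | ∈-filter⁺ (λ (e : ℕ × ℕ) → proj₁ e ≟ u) e₁ refl | ∈-filter⁺ (λ (e : ℕ × ℕ) → proj₁ e ≟ u) e₂ refl | one
  ... | _ ∷ [] | here refl | here refl | _ = refl

  module _ {n} (C : Circuit F n) where
    reach-≤ : ∀ {u v} → Reach F C u v → u ≤ v
    reach-≤ reach-refl       = ≤-refl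
    reach-≤ (reach-step e r) = ≤-trans (<⇒≤ (proj₁ (edge-< F C e))) (reach-≤ r)

    reach-trans : ∀ {u v w} → Reach F C u v → Reach F C v w → Reach F C u w
    reach-trans reach-refl       s = s
    reach-trans (reach-step e r) s = reach-step e (reach-trans r s)

    private
      -- Edges increase gate numbers, so `n ≤ u + f` persists along the search; without fuel, `u` is
      -- out of range and has no outgoing edge.
      reach?-fuel : ∀ f u v → n ≤ u + f → Dec (Reach F C u v)
      reach?-fuel f u v n≤ with u ≟ v
      ... | yes refl = yes reach-refl
      reach?-fuel zero u v n≤ | no u≢v = no λ
        { reach-refl       → u≢v refl
        ; (reach-step e _) → let u<w , w<n = edge-< F C e in
            <-irrefl refl (<-trans (<-≤-trans w<n (≤-trans n≤ (≤-reflexive (+-identityʳ u)))) u<w) }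
      reach?-fuel (suc f) u v n≤ | no u≢v with Any.any? edge? (edges F C)
        where
        -- The predicate is decided on arbitrary pairs, not only on edges; `u < proj₂ e` is
        -- therefore tested explicitly to justify the recursive call.
        edge? : Decidable (λ (e : ℕ × ℕ) → proj₁ e ≡ u × Reach F C (proj₂ e) v × u < proj₂ e)
        edge? (x , w) with x ≟ u | u <? w
        ... | no x≢u   | _       = no (x≢u ∘ proj₁)
        ... | yes _    | no u≮w  = no (u≮w ∘ proj₂ ∘ proj₂)
        ... | yes x≡u  | yes u<w with reach?-fuel f w v
            (≤-trans n≤ (≤-trans (≤-reflexive (+-suc u f)) (+-monoˡ-≤ f u<w)))
        ... | yes r = yes (x≡u , r , u<w)
        ... | no ¬r = no (¬r ∘ proj₁ ∘ proj₂)
      ... | yes any = let (x , w) , e∈ , eq , r , _ = find any in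
                      yes (reach-step (subst (λ x → (x , w) ∈ edges F C) eq e∈) r)
      ... | no ¬any = no λ
        { reach-refl       → u≢v refl
        ; (reach-step e r) → ¬any (Any.map (λ { refl → refl , r , proj₁ (edge-< F C e) }) e) }

    reach? : ∀ u v → Dec (Reach F C u v)
    reach? u v = reach?-fuel n u v (m≤n+m n u)

  -- In prd β γ the isolated factor is γ.
  data Instruction : Set c where
    inp : Input F → Instruction
    lin : List (K × ℕ) → Instruction
    prd : ℕ → ℕ → Instruction

  module WeaklySkewCircuit {t} (C : Circuit F t) (weakly-skew : WeaklySkew F C) where
    record IsProduct (α β γ : ℕ) : Set (c ⊔ ℓ) where
      field
        edgeˡ    : (β , α) ∈ edges F C
        edgeʳ    : (γ , α) ∈ edges F C
        β≢γ      : β ≢ γ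
        isolated : Isolated F C γ
        value≋   : _≋_ F (value F C α) (value F C β ⊗ value F C γ)
        degree≡  : degree F C α ≡ degree F C β + degree F C γ

    -- Numbers out of range are read as the empty sum, which makes `instr` total.
    data Spec (k : ℕ) : Instruction → Set (c ⊔ ℓ) where
      inpS : ∀ {x} → GateAt F C k (inputGate F x) → Spec k (inp x)
      linS : ∀ {ws} → GateAt F C k (add ws) → Spec k (lin (map (λ (w , j) → w , toℕ j) ws))
      prdS : ∀ {β γ} → IsProduct k β γ → Spec k (prd β γ)
      outS : t ≤ k → Spec k (lin [])

    -- Opaque, because everything below uses an instruction only through its `Spec`.
    abstract
      compile : ∀ k → Σ Instruction (Spec k)
      compile k with k <? t
      ... | no k≮t = lin [] , outS (≮⇒≥ k≮t)
      ... | yes k<t with findGate F C k<t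
      ... | var x , p = inp (indeterminate x) , inpS p
      ... | cst a , p = inp (constant a) , inpS p
      ... | add ws , p = _ , linS p
      ... | mul js , p with weakly-skew k js p
      ... | β , γ , refl , iso = go iso
        where
        -- The isolated factor has fan-out one and so cannot fill both inputs of the product.
        distinct : ∀ {i} → fanout F C i ≡ 1 → toℕ β ≡ i → toℕ γ ≡ i → ⊥
        distinct {i} one eq₁ eq₂ = <-irrefl refl (begin-strict
          1                              <⟨ ≤-refl ⟩
          2                              ≡⟨ cong length (trans (filter-accept (_≟ i) eq₁) (cong (_ ∷_) (filter-accept (_≟ i) eq₂))) ⟨
          count i (toℕ β ∷ toℕ γ ∷ [])   ≤⟨ count≤fanout i p ⟩
          fanout F C i                   ≡⟨ one ⟩
          1                              ∎)
          where open ≤-Reasoning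
        go : Isolated F C (toℕ β) ⊎ Isolated F C (toℕ γ) → Σ Instruction (Spec k)
        go (inj₁ iso) = prd (toℕ γ) (toℕ β) , prdS (record
          { edgeˡ = gate⇒edge F p (there (here refl)) ; edgeʳ = gate⇒edge F p (here refl)
          ; β≢γ = distinct (proj₁ iso) refl ; isolated = iso
          ; value≋ = ≋-trans (≡⇒≋ F (Value.at-GateAt F p))
              (≋-trans (⊗-comm _ _) (⊗-cong (⊗-idʳ F _) ≋-refl))
          ; degree≡ = trans (Degree.at-GateAt F p) (trans (+-comm (degree F C (toℕ β)) _)
              (cong (_+ degree F C (toℕ β)) (+-identityʳ _))) })
        go (inj₂ iso) = prd (toℕ β) (toℕ γ) , prdS (record
          { edgeˡ = gate⇒edge F p (here refl) ; edgeʳ = gate⇒edge F p (there (here refl))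
          ; β≢γ = λ eq → distinct (proj₁ iso) eq refl ; isolated = iso
          ; value≋ = ≋-trans (≡⇒≋ F (Value.at-GateAt F p)) (⊗-cong ≋-refl (⊗-idʳ F _))
          ; degree≡ = trans (Degree.at-GateAt F p) (cong (degree F C (toℕ β) +_) (+-identityʳ _)) })

    instr : ℕ → Instruction
    instr k = proj₁ (compile k)

    spec : ∀ k → Spec k (instr k)
    spec k = proj₂ (compile k)

    Contains : ℕ → ℕ → Set c
    Contains α u = ∃[ β ] ∃[ γ ] (instr α ≡ prd β γ × Reach F C u γ)

    contains? : ∀ u → Decidable (λ α → Contains α u)
    contains? u α with instr α
    ... | inp _   = no λ { (_ , _ , () , _) }
    ... | lin _   = no λ { (_ , _ , () , _) }
    ... | prd β γ with reach? C u γ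
    ... | yes r = yes (β , γ , refl , r)
    ... | no ¬r = no λ { (_ , _ , refl , r) → ¬r r }

    product : ∀ {α β γ} → instr α ≡ prd β γ → IsProduct α β γ
    product {α} eq with spec α
    ... | s with instr α
    product refl | prdS p | _ = p

    -- The stack of products around `u`. In increasing order the innermost product comes first,
    -- since nested isolated subcircuits grow with the number of their product.
    containers : ℕ → List ℕ
    containers u = filter (contains? u) (upTo t)

    open IsProduct

    -- An isolated subcircuit can only be left through the edge from its root to its product. Every
    -- other edge joins gates that lie in the same isolated subcircuits.
    containers-edge : ∀ {k v} → (k , v) ∈ edges F C → (∀ {β γ} → instr v ≡ prd β γ → k ≢ γ) →
      containers k ≡ containers v
    containers-edge {k} {v} e other = filter-cong-∈ _ _ (upTo t) (λ _ → to) (λ _ → from)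
      where
      to : ∀ {α} → Contains α k → Contains α v
      to (β , γ , eq , r) with k ≟ γ
      ... | no k≢γ   = β , γ , eq , proj₂ (isolated (product eq)) k v e r k≢γ
      ... | yes refl with fanout≡1⇒unique C (proj₁ (isolated (product eq))) e (edgeʳ (product eq))
      ... | refl = contradiction refl (other eq)
      from : ∀ {α} → Contains α v → Contains α k
      from (β , γ , eq , r) = β , γ , eq , reach-step e r

    α<t : ∀ {α β γ} → instr α ≡ prd β γ → α < t
    α<t eq = proj₂ (edge-< F C (edgeʳ (product eq)))

    β<t : ∀ {α β γ} → instr α ≡ prd β γ → β < t
    β<t eq = <-trans (proj₁ (edge-< F C (edgeˡ (product eq)))) (α<t eq)

    containers-β : ∀ {α β γ} → instr α ≡ prd β γ → containers β ≡ containers α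
    containers-β eq = containers-edge (edgeˡ (product eq))
      λ { eq′ refl → β≢γ (product eq′) (cong left (trans (sym eq′) eq)) }
      where
      left : Instruction → ℕ
      left (prd β γ) = β
      left _         = 0

    -- The only edge out of `γ` leads to `α`, so a further subcircuit containing `γ` also contains
    -- `α`: descending into the isolated factor pushes `α` and nothing else.
    containers-γ : ∀ {α β γ} → instr α ≡ prd β γ → containers γ ≡ α ∷ containers α
    containers-γ {α} {β} {γ} eq = filter-insert (contains? α) (contains? γ) (upTo-sorted t)
      (∈-upTo⁺ (α<t eq)) (β , γ , eq , reach-refl) above (λ _ → up) (λ _ → down)
      where
      above : ∀ {x} → Contains x α → α < x
      above (_ , _ , eq′ , r) = ≤-<-trans (reach-≤ C r) (proj₁ (edge-< F C (edgeʳ (product eq′))))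
      up : ∀ {x} → Contains x α → Contains x γ
      up (β′ , γ′ , eq′ , r) = β′ , γ′ , eq′ , reach-step (edgeʳ (product eq)) r
      down : ∀ {x} → Contains x γ → x ≡ α ⊎ Contains x α
      down (β′ , γ′ , eq′ , reach-refl) =
        inj₁ (fanout≡1⇒unique C (proj₁ (isolated (product eq))) (edgeʳ (product eq′)) (edgeʳ (product eq)))
      down (β′ , γ′ , eq′ , reach-step e r)
        with refl ← fanout≡1⇒unique C (proj₁ (isolated (product eq))) e (edgeʳ (product eq)) =
        inj₂ (β′ , γ′ , eq′ , r)

    -- Follow the path from `u` to `γ′`: by isolation it stays in the subcircuit of `γ` until it
    -- meets `γ`. If it ended before, `γ′` would lie strictly inside that subcircuit, hence `α′`
    -- would reach `γ` and be smaller than `α`.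
    laminar : ∀ {α α′ β β′ γ γ′ u} → instr α ≡ prd β γ → instr α′ ≡ prd β′ γ′ → α ≤ α′ →
      Reach F C u γ → Reach F C u γ′ → Reach F C γ γ′
    laminar eq eq′ α≤α′ reach-refl r′ = r′
    laminar eq eq′ α≤α′ (reach-step e r) reach-refl
      with refl ← fanout≡1⇒unique C (proj₁ (isolated (product eq′))) e (edgeʳ (product eq′)) =
      contradiction (≤-<-trans (reach-≤ C r) (proj₁ (edge-< F C (edgeʳ (product eq))))) (≤⇒≯ α≤α′)
    laminar {γ = γ} {u = u} eq eq′ α≤α′ r@(reach-step _ _) (reach-step {v = v} e r′) with u ≟ γ
    ... | yes refl = reach-step e r′
    ... | no u≢γ   = laminar eq eq′ α≤α′ (proj₂ (isolated (product eq)) u v e r u≢γ) r′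

    -- By `laminar`, `u` has the same stack as the isolated factor `γ` of its innermost product `α`.
    -- Popping `α` leaves the stack of `α`, which is also the stack of `β`. So an input edge from
    -- `β` to `u` starts with exactly the rest of the stack of `u`.
    containers-head : ∀ {u α β γ αs} → containers u ≡ α ∷ αs → instr α ≡ prd β γ → containers β ≡ αs
    containers-head {u} {α} {β} {γ} {αs} eq eqα with ∈-filter⁻ (contains? u) {xs = upTo t} (subst (α ∈_) (sym eq) (here refl))
    ... | _ , _ , _ , eqα′ , r with refl ← trans (sym eqα) eqα′ =
      trans (containers-β eqα) (∷-injectiveʳ (trans (sym (containers-γ eqα)) (trans same eq)))
      where
      least : ∀ {x} → x ∈ upTo t → Contains x u → α ≤ x
      least {x} x∈ cx with subst (AllPairs _<_) eq (AllPairs.filter⁺ (contains? u) (upTo-sorted t))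
                         | subst (x ∈_) eq (∈-filter⁺ (contains? u) x∈ cx)
      ... | _       | here refl = ≤-refl
      ... | α< ∷ _  | there x∈′ = <⇒≤ (All.lookup α< x∈′)
      same : containers γ ≡ containers u
      same = filter-cong-∈ _ _ (upTo t)
        (λ { _ (β′ , γ′ , eq′ , r′) → β′ , γ′ , eq′ , reach-trans C r r′ })
        (λ { x∈ cx@(β′ , γ′ , eq′ , r′) → β′ , γ′ , eq′ , laminar eqα eq′ (least x∈ cx) r r′ })

    -- The output feeds no gate, so its vertex carries no partner besides its own value.
    containers-last : ∀ {m} → t ≡ suc m → containers m ≡ []
    containers-last {m} refl = filter-none (contains? m) {xs = upTo t} (All.universal (λ { x (_ , _ , eq , r) →
      <⇒≱ (<-≤-trans (proj₁ (edge-< F C (edgeʳ (product eq)))) (≤-pred (α<t eq))) (reach-≤ C r) }) (upTo t))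

-- The branching program

iterate : ∀ {a} {A : Set a} → ℕ → (A → A) → A → A
iterate zero    f x = x
iterate (suc k) f x = f (iterate k f x)

module _ {c ℓ : Level} (F : Field c ℓ) where
  open Field F using (commutativeRing)
  open CommutativeRing commutativeRing using (0#; 1#) renaming (Carrier to K; _+_ to _+K_; _*_ to _*K_)

  module BranchingProgram {t} (C : Circuit F t) (weakly-skew : WeaklySkew F C) where
    open WeaklySkewCircuit F C weakly-skew
    open IsProduct

    input-gate : ∀ {k x} → instr k ≡ inp x → GateAt F C k (inputGate F x)
    input-gate {k} eq with instr k | spec k
    input-gate refl | _ | inpS p = p

    input-value : ∀ {k} x → GateAt F C k (inputGate F x) → value F C k ≡ ⟦_⟧ᵢ F x
    input-value (indeterminate x) p = Value.at-GateAt F p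
    input-value (constant a)  p = Value.at-GateAt F p

    input-degree : ∀ {k} x → GateAt F C k (inputGate F x) → degree F C k ≡ 1
    input-degree (indeterminate x) p = Degree.at-GateAt F p
    input-degree (constant a)  p = Degree.at-GateAt F p

    record IsSum (k : ℕ) (ws : List (K × ℕ)) : Set (c ⊔ ℓ) where
      field
        sum-edge        : ∀ {w i} → (w , i) ∈ ws → (i , k) ∈ edges F C
        sum-value       : value F C k ≡ ∑ F ws (λ (w , i) → con w ⊗ value F C i)
        summand-degree≤ : ∀ {w i} → (w , i) ∈ ws → degree F C i ≤ degree F C k
        degree-attained : degree F C k ≡ 0 ⊎ ∃[ w ] ∃[ i ] ((w , i) ∈ ws × degree F C k ≡ degree F C i)
    open IsSum

    linear : ∀ {k ws} → k < t → instr k ≡ lin ws → IsSum k ws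
    linear {k} k<t eq with instr k | spec k
    linear k<t refl | _ | outS t≤k = contradiction k<t (≤⇒≯ t≤k)
    linear {k} k<t refl | _ | linS {gs} p = record
      { sum-edge = edge ; sum-value = trans (Value.at-GateAt F p) (sym (∑-map F flat gs _))
      ; summand-degree≤ = λ w∈ → subst (degree F C _ ≤_) (sym deg) (≤max gs w∈)
      ; degree-attained = subst (λ d → d ≡ 0 ⊎ ∃[ w ] ∃[ i ] ((w , i) ∈ map flat gs × d ≡ degree F C i)) (sym deg) (max gs) }
      where
      flat : K × Fin k → K × ℕ
      flat (w , j) = w , toℕ j
      maxdeg : List (K × Fin k) → ℕ
      maxdeg = foldr (λ w acc → degree F C (toℕ (proj₂ w)) ⊔ℕ acc) 0
      deg : degree F C k ≡ maxdeg gs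
      deg = Degree.at-GateAt F p
      edge : ∀ {w i} → (w , i) ∈ map flat gs → (i , k) ∈ edges F C
      edge w∈ with ∈-map⁻ flat w∈
      ... | _ , g∈ , refl = gate⇒edge F p (∈-map⁺ (λ w → toℕ (proj₂ w)) g∈)
      ≤max : ∀ gs {w i} → (w , i) ∈ map flat gs → degree F C i ≤ maxdeg gs
      ≤max (g ∷ gs) (here refl) = m≤m⊔n _ _
      ≤max (g ∷ gs) (there w∈)  = ≤-trans (≤max gs w∈) (m≤n⊔m (degree F C (toℕ (proj₂ g))) _)
      max : ∀ gs → maxdeg gs ≡ 0 ⊎ ∃[ w ] ∃[ i ] ((w , i) ∈ map flat gs × maxdeg gs ≡ degree F C i)
      max []             = inj₁ refl
      max ((w , j) ∷ gs) with ⊔-sel (degree F C (toℕ j)) (maxdeg gs) | max gs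
      ... | inj₁ eq | _       = inj₂ (w , toℕ j , here refl , eq)
      ... | inj₂ eq | inj₁ z  = inj₁ (trans eq z)
      ... | inj₂ eq | inj₂ (w′ , i , w∈ , eq′) = inj₂ (w′ , i , there w∈ , trans eq eq′)

    -- Inputs have degree one, so degree zero originates in empty sums, and sums and products of
    -- such gates vanish too. This is what makes zero input edges sufficient for degree zero.
    degree-zero : ∀ k → k < t → degree F C k ≡ 0 → _≋_ F (value F C k) (con 0#)
    degree-zero = <-rec _ go
      where
      go : ∀ k → (∀ {i} → i < k → i < t → degree F C i ≡ 0 → _≋_ F (value F C i) (con 0#)) →
        k < t → degree F C k ≡ 0 → _≋_ F (value F C k) (con 0#)
      go k ih k<t d≡0 with instr k in eq
      ... | inp x = contradiction (trans (sym d≡0) (input-degree x (input-gate eq))) λ ()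
      ... | lin ws = ≋-trans (≡⇒≋ F (sum-value s)) (∑-zero-∈ F ws λ {(w , i)} w∈ →
            let i<k , _ = edge-< F C (sum-edge s w∈) in
            ≋-trans (⊗-cong ≋-refl (ih i<k (<-trans i<k k<t)
              (n≤0⇒n≡0 (subst (degree F C i ≤_) d≡0 (summand-degree≤ s w∈))))) (⊗-zeroʳ F _))
        where s = linear k<t eq
      ... | prd β γ = ≋-trans (value≋ p) (≋-trans
            (⊗-cong (ih β<k (<-trans β<k k<t) (m+n≡0⇒m≡0 _ (trans (sym (degree≡ p)) d≡0))) ≋-refl) (⊗-zeroˡ _))
        where
        p = product eq
        β<k = proj₁ (edge-< F C (edgeˡ p))

    -- A path from a gate below `γ` to `β` would have to leave the subcircuit of `γ` through the
    -- edge to `α`, but `α` comes after `β`.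
    disjoint : ∀ {α β γ u} → IsProduct α β γ → Reach F C u β → ¬ Reach F C u γ
    disjoint {α} {β} {γ} p rβ rγ = go rβ rγ
      where
      go : ∀ {u} → Reach F C u β → ¬ Reach F C u γ
      go reach-refl r = <⇒≱ (proj₁ (edge-< F C (edgeʳ p)))
        (reach-≤ F C (proj₂ (isolated p) β α (edgeˡ p) r (β≢γ p)))
      go {u} (reach-step {v = v} e rβ) r with u ≟ γ
      ... | no u≢γ   = go rβ (proj₂ (isolated p) u v e r u≢γ)
      ... | yes refl with refl ← fanout≡1⇒unique F C (proj₁ (isolated p)) e (edgeʳ p) =
        <⇒≱ (proj₁ (edge-< F C (edgeˡ p))) (reach-≤ F C rβ)

    -- The degree is charged to distinct gates: a sum attains its degree in one summand, and for a
    -- product the gates charged below the two factors are disjoint. Without weak skewness the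
    -- degree could be exponential in the size.
    degree≤size : ∀ {k} → k < t → degree F C k ≤ t
    degree≤size {k} k<t =
      let L , u , r , d≤ = subcircuit k k<t in
      ≤-trans d≤ (Unique⇒length≤ u (All.map (λ r → ≤-<-trans (reach-≤ F C r) k<t) r))
      where
      Sub : ℕ → Set c
      Sub k = ∃[ L ] (Unique L × All (λ i → Reach F C i k) L × degree F C k ≤ length L)
      go : ∀ k → (∀ {i} → i < k → i < t → Sub i) → k < t → Sub k
      go k ih k<t with instr k in eq
      ... | inp x = k ∷ [] , [] ∷ [] , reach-refl ∷ [] , ≤-reflexive (input-degree x (input-gate eq))
      ... | lin ws with degree-attained (linear k<t eq)
      ...   | inj₁ z = [] , [] , [] , ≤-reflexive z
      ...   | inj₂ (w , i , w∈ , d≡) =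
        let e = sum-edge (linear k<t eq) w∈
            i<k , _ = edge-< F C e
            L , u , r , d≤ = ih i<k (<-trans i<k k<t)
        in L , u , All.map (λ r → reach-trans F C r (reach-step e reach-refl)) r , ≤-trans (≤-reflexive d≡) d≤
      go k ih k<t | prd β γ =
        let p = product eq
            β<k , _ = edge-< F C (edgeˡ p)
            γ<k , _ = edge-< F C (edgeʳ p)
            L₁ , u₁ , r₁ , d₁ = ih β<k (<-trans β<k k<t)
            L₂ , u₂ , r₂ , d₂ = ih γ<k (<-trans γ<k k<t)
        in L₁ ++ L₂
         , Unique.++⁺ u₁ u₂ (λ (i∈₁ , i∈₂) → disjoint p (All.lookup r₁ i∈₁) (All.lookup r₂ i∈₂))
         , All.++⁺ (All.map (λ r → reach-trans F C r (reach-step (edgeˡ p) reach-refl)) r₁)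
                   (All.map (λ r → reach-trans F C r (reach-step (edgeʳ p) reach-refl)) r₂)
         , ≤-trans (≤-reflexive (degree≡ p)) (≤-trans (+-mono-≤ d₁ d₂) (≤-reflexive (sym (length-++ L₁))))
      subcircuit : ∀ k → k < t → Sub k
      subcircuit = <-rec _ go

    left : Instruction F → ℕ
    left (prd β γ) = β
    left _         = 0

    partner : ℕ → ℕ
    partner α = left (instr α)

    prefix : List ℕ → Expr F
    prefix αs = ∏ F αs (value F C ∘ partner)

    prefixDegree : List ℕ → ℕ
    prefixDegree = foldr (λ α d → degree F C (partner α) + d) 0

    -- Vertex 0 of the branching program is its source, vertex suc u is gate u.
    source : List ℕ → ℕ
    source []      = 0
    source (α ∷ _) = suc (partner α)

    -- The intended sum over all walks from the source: on arrival at `u` a walk has also multiplied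
    -- in the partners of all products around `u`.
    vertexValue : ℕ → Expr F
    vertexValue zero    = con 1#
    vertexValue (suc u) = value F C u ⊗ prefix (containers u)

    -- The formal degree of `vertexValue`; it bounds the number of input edges on walks to the
    -- vertex.
    vertexDegree : ℕ → ℕ
    vertexDegree zero    = 0
    vertexDegree (suc u) = degree F C u + prefixDegree (containers u)

    container-product : ∀ {u α αs} → containers u ≡ α ∷ αs → ∃[ γ ] (instr α ≡ prd (partner α) γ)
    container-product {u} {α} eq with ∈-filter⁻ (contains? u) {xs = upTo t} (subst (α ∈_) (sym eq) (here refl))
    ... | _ , β , γ , eq′ , _ = γ , trans eq′ (cong (λ i → prd (left i) γ) (sym eq′))

    -- The source of the input edge at `u` supplies one partner as its own value and, by
    -- `containers-head`, the remaining ones as its prefix.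
    vertexValue-source : ∀ u → vertexValue (source (containers u)) ≡ prefix (containers u)
    vertexValue-source u with containers u in eq
    ... | []     = refl
    ... | α ∷ αs = let _ , eq′ = container-product eq in
      cong (λ αs → value F C (partner α) ⊗ prefix αs) (containers-head eq eq′)

    vertexDegree-source : ∀ u → vertexDegree (source (containers u)) ≡ prefixDegree (containers u)
    vertexDegree-source u with containers u in eq
    ... | []     = refl
    ... | α ∷ αs = let _ , eq′ = container-product eq in
      cong (λ αs → degree F C (partner α) + prefixDegree αs) (containers-head eq eq′)

    source≤ : ∀ u → source (containers u) ≤ t
    source≤ u with containers u in eq
    ... | []    = z≤n
    ... | _ ∷ _ = β<t (proj₂ (container-product eq))

    δ : ℕ → ℕ → K
    δ u v = if does (u ≟ v) then 1# else 0#

    δ-self : ∀ u → δ u u ≡ 1#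
    δ-self u = cong (if_then 1# else 0#) (dec-true (u ≟ u) refl)

    δ-other : ∀ {u v} → u ≢ v → δ u v ≡ 0#
    δ-other {u} {v} u≢v = cong (if_then 1# else 0#) (dec-false (u ≟ v) u≢v)

    -- A product has an edge from its isolated factor alone: the partner was multiplied in before
    -- that factor was entered.
    constantEdges : Instruction F → List (K × ℕ)
    constantEdges (inp _)   = []
    constantEdges (lin ws)  = ws
    constantEdges (prd β γ) = (1# , γ) ∷ []

    -- Total weight of the walks of constant edges with fewer than f edges from
    -- vertex v to gate g.
    closure : (f v g : ℕ) → K
    closure zero    v g = 0#
    closure (suc f) v g =
      δ v (suc g) +K foldr (λ (w , i) acc → (w *K closure f v i) +K acc) 0# (constantEdges (instr g))

    inputEntry : Instruction F → (u s : ℕ) → Input F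
    inputEntry (inp x) u s = if does (u ≟ s) then x else constant 0#
    inputEntry _       u s = constant 0#

    -- Only the source has a loop in `inputStep`; together with the one in `constantStep` it lets
    -- walks with fewer input edges wait at the source. Constant edges increase gate numbers, so
    -- `closure t` covers all walks of such edges, the empty one included.
    inputStep constantStep : ℕ → ℕ → Input F
    inputStep u zero    = constant (δ u 0)
    inputStep u (suc g) = inputEntry (instr g) u (source (containers g))
    constantStep u zero    = constant (δ u 0)
    constantStep u (suc g) = constant (closure t u g)

    V : List ℕ
    V = upTo (suc t)

    open SetoidReasoning (≋-setoid F)

    ∑-δ : ∀ (y : ℕ → Expr F) {j} → j ≤ t → _≋_ F (∑ F V (λ u → y u ⊗ con (δ u j))) (y j)
    ∑-δ y {j} j≤t = ≋-trans
      (∑-single F (Unique.upTo⁺ (suc t)) (∈-upTo⁺ (s≤s j≤t)) λ u≢j →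
        ≋-trans (⊗-cong ≋-refl (≡⇒≋ F (cong con (δ-other u≢j)))) (⊗-zeroʳ F _))
      (≋-trans (⊗-cong ≋-refl (≡⇒≋ F (cong con (δ-self j)))) (⊗-idʳ F _))

    inputStep-zero : ∀ y → _≋_ F (act F (⟦_⟧ᵢ F) V y inputStep 0) (y 0)
    inputStep-zero y = ∑-δ y z≤n

    inputStep-inp : ∀ y {g x} → instr g ≡ inp x →
      _≋_ F (act F (⟦_⟧ᵢ F) V y inputStep (suc g)) (y (source (containers g)) ⊗ ⟦_⟧ᵢ F x)
    inputStep-inp y {g} {x} eq rewrite eq = ≋-trans
      (∑-single F (Unique.upTo⁺ (suc t)) (∈-upTo⁺ (s≤s (source≤ g))) λ {u} u≢s →
        ≋-trans (⊗-cong ≋-refl (≡⇒≋ F (cong (λ b → ⟦_⟧ᵢ F (if b then x else constant 0#)) (dec-false (u ≟ _) u≢s)))) (⊗-zeroʳ F _))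
      (⊗-cong ≋-refl (≡⇒≋ F (cong (λ b → ⟦_⟧ᵢ F (if b then x else constant 0#)) (dec-true (source (containers g) ≟ _) refl))))

    inputStep-other : ∀ y {g} → (∀ {x} → instr g ≢ inp x) →
      _≋_ F (act F (⟦_⟧ᵢ F) V y inputStep (suc g)) (con 0#)
    inputStep-other y {g} h = ∑-zero-∈ F V λ {u} _ →
      ≋-trans (⊗-cong ≋-refl (≡⇒≋ F (entry u (instr g) h))) (⊗-zeroʳ F _)
      where
      entry : ∀ u i → (∀ {x} → i ≢ inp x) → ⟦_⟧ᵢ F (inputEntry i u (source (containers g))) ≡ con 0#
      entry u (inp x)   h = contradiction refl h
      entry u (lin _)   h = refl
      entry u (prd _ _) h = refl

    through : ℕ → (ℕ → Expr F) → ℕ → Expr F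
    through f y g = ∑ F V (λ v → y v ⊗ con (closure f v g))

    con-foldr : ∀ (f : ℕ → K) (ws : List (K × ℕ)) →
      _≋_ F (con (foldr (λ (w , i) acc → (w *K f i) +K acc) 0# ws)) (∑ F ws (λ (w , i) → con w ⊗ con (f i)))
    con-foldr f []             = ≋-refl
    con-foldr f ((w , i) ∷ ws) = ≋-trans (≋-sym (con-+ _ _)) (⊕-cong (≋-sym (con-* _ _)) (con-foldr f ws))

    -- A walk of constant edges is empty or has a last edge, and the last edge is split off.
    through-suc : ∀ f y {g i} → g < t → instr g ≡ i → _≋_ F (through (suc f) y g)
      (y (suc g) ⊕ ∑ F (constantEdges i) (λ (w , i) → con w ⊗ through f y i))
    through-suc f y {g} g<t refl = begin
      ∑ F V (λ v → y v ⊗ con (closure (suc f) v g))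
        ≈⟨ ∑-cong F V (λ v → ≋-trans (⊗-cong ≋-refl (≋-sym (con-+ _ _))) (distribˡ _ _ _)) ⟩
      ∑ F V (λ v → (y v ⊗ con (δ v (suc g))) ⊕ (y v ⊗ con (rest v)))
        ≈⟨ ∑-⊕ F V _ _ ⟩
      ∑ F V (λ v → y v ⊗ con (δ v (suc g))) ⊕ ∑ F V (λ v → y v ⊗ con (rest v))
        ≈⟨ ⊕-cong (∑-δ y g<t) (∑-cong F V λ v → ≋-trans (⊗-cong ≋-refl (con-foldr (closure f v) es)) (⊗-∑ F _ es _)) ⟩
      y (suc g) ⊕ ∑ F V (λ v → ∑ F es (λ (w , i) → y v ⊗ (con w ⊗ con (closure f v i))))
        ≈⟨ ⊕-cong ≋-refl (∑-swap F V es _) ⟩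
      y (suc g) ⊕ ∑ F es (λ (w , i) → ∑ F V (λ v → y v ⊗ (con w ⊗ con (closure f v i))))
        ≈⟨ ⊕-cong ≋-refl (∑-cong F es λ _ → ≋-trans (∑-cong F V λ _ → ⊗-swapˡ F _ _ _) (≋-sym (⊗-∑ F _ V _))) ⟩
      y (suc g) ⊕ ∑ F es (λ (w , i) → con w ⊗ through f y i) ∎
      where
      es = constantEdges (instr g)
      rest : ℕ → K
      rest v = foldr (λ (w , i) acc → (w *K closure f v i) +K acc) 0# es

    step : (ℕ → Expr F) → ℕ → Expr F
    step y = act F (⟦_⟧ᵢ F) V (act F (⟦_⟧ᵢ F) V y inputStep) constantStep

    initial : ℕ → Expr F
    initial zero    = con 1#
    initial (suc _) = con 0#

    -- Walks with k input edges suffice for the vertices of degree at most k.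
    Correct : ℕ → (ℕ → Expr F) → Set (c ⊔ ℓ)
    Correct k y = ∀ v → v ≤ t → vertexDegree v ≤ k → _≋_ F (y v) (vertexValue v)

    -- Besides the source, only vertices whose gate has degree zero are concerned, and their values
    -- vanish by `degree-zero`.
    initial-correct : Correct 0 initial
    initial-correct zero    _   _   = ≋-refl
    initial-correct (suc g) g<t d≤0 = ≋-sym (≋-trans
      (⊗-cong (degree-zero g g<t (m+n≡0⇒m≡0 _ (n≤0⇒n≡0 d≤0))) ≋-refl) (⊗-zeroˡ _))

    -- For fixed `k` the gates are treated in increasing order: stepping back along a constant edge
    -- does not raise `vertexDegree`, and stepping back along an input edge lowers it by one.
    step-correct : ∀ {k y} → Correct k y → Correct (suc k) (step y)
    step-correct {k} {y} cor zero _ _ = ≋-trans (∑-δ _ z≤n) (≋-trans (inputStep-zero y) (cor 0 z≤n z≤n))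
    step-correct {k} {y} cor (suc g) g<t d≤ = go t g g<t g<t d≤
      where
      y′ = act F (⟦_⟧ᵢ F) V y inputStep
      -- The fuel stays above the gate number, because constant edges enter `g` from smaller gates;
      -- it starts at `t`, as in `constantStep`.
      go : ∀ f g → g < f → g < t → vertexDegree (suc g) ≤ suc k →
        _≋_ F (through f y′ g) (vertexValue (suc g))
      go (suc f) g (s≤s g≤f) g<t d≤ = cases (instr g) refl
        where
        cases : ∀ i → instr g ≡ i → _≋_ F (through (suc f) y′ g) (vertexValue (suc g))
        cases (inp x) eq = begin
          through (suc f) y′ g                      ≈⟨ through-suc f y′ g<t eq ⟩
          y′ (suc g) ⊕ con 0#                       ≈⟨ ⊕-idʳ F _ ⟩
          y′ (suc g)                                ≈⟨ inputStep-inp y eq ⟩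
          y (source (containers g)) ⊗ ⟦_⟧ᵢ F x      ≈⟨ ⊗-cong (cor _ (source≤ g) deg) ≋-refl ⟩
          vertexValue (source (containers g)) ⊗ ⟦_⟧ᵢ F x
            ≈⟨ ⊗-cong (≡⇒≋ F (vertexValue-source g)) (≡⇒≋ F (sym (input-value x (input-gate eq)))) ⟩
          prefix (containers g) ⊗ value F C g       ≈⟨ ⊗-comm _ _ ⟩
          vertexValue (suc g)                       ∎
          where
          -- The input gate has degree one, and this unit pays for the passage from `suc k` to `k`.
          deg : vertexDegree (source (containers g)) ≤ k
          deg = subst (_≤ k) (sym (vertexDegree-source g))
            (≤-pred (subst (λ d → d + prefixDegree (containers g) ≤ suc k) (input-degree x (input-gate eq)) d≤))
        cases (lin ws) eq = begin
          through (suc f) y′ g                                          ≈⟨ through-suc f y′ g<t eq ⟩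
          y′ (suc g) ⊕ ∑ F ws (λ (w , i) → con w ⊗ through f y′ i)
            ≈⟨ ⊕-cong (inputStep-other y λ e → contradiction (trans (sym eq) e) λ ()) ≋-refl ⟩
          con 0# ⊕ ∑ F ws (λ (w , i) → con w ⊗ through f y′ i)          ≈⟨ ⊕-idˡ _ ⟩
          ∑ F ws (λ (w , i) → con w ⊗ through f y′ i)                   ≈⟨ ∑-cong-∈ F ws summand ⟩
          ∑ F ws (λ (w , i) → (con w ⊗ value F C i) ⊗ prefix (containers g)) ≈⟨ ∑-⊗ F _ ws _ ⟨
          ∑ F ws (λ (w , i) → con w ⊗ value F C i) ⊗ prefix (containers g)
            ≈⟨ ⊗-cong (≡⇒≋ F (sym (sum-value s))) ≋-refl ⟩
          vertexValue (suc g)                                           ∎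
          where
          s = linear g<t eq
          summand : ∀ {e} → e ∈ ws → _≋_ F (con (proj₁ e) ⊗ through f y′ (proj₂ e))
            ((con (proj₁ e) ⊗ value F C (proj₂ e)) ⊗ prefix (containers g))
          summand {w , i} e∈ =
            let i<g , _ = edge-< F C (sum-edge s e∈)
                same : containers i ≡ containers g
                same = containers-edge (sum-edge s e∈) λ e → contradiction (trans (sym eq) e) λ ()
            in ≋-trans (⊗-cong ≋-refl (≋-trans
                 (go f i (<-≤-trans i<g g≤f) (<-trans i<g g<t)
                   (≤-trans (+-mono-≤ (summand-degree≤ s e∈) (≤-reflexive (cong prefixDegree same))) d≤))
                 (≡⇒≋ F (cong (λ αs → value F C i ⊗ prefix αs) same))))
               (≋-sym (⊗-assoc _ _ _))
        cases (prd β γ) eq = begin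
          through (suc f) y′ g                                ≈⟨ through-suc f y′ g<t eq ⟩
          y′ (suc g) ⊕ ((con 1# ⊗ through f y′ γ) ⊕ con 0#)
            ≈⟨ ⊕-cong (inputStep-other y λ e → contradiction (trans (sym eq) e) λ ()) (≋-trans (⊕-idʳ F _) (⊗-idˡ _)) ⟩
          con 0# ⊕ through f y′ γ                             ≈⟨ ⊕-idˡ _ ⟩
          through f y′ γ                                      ≈⟨ go f γ (<-≤-trans γ<g g≤f) (<-trans γ<g g<t) deg ⟩
          value F C γ ⊗ prefix (containers γ)                 ≈⟨ ⊗-cong ≋-refl (≡⇒≋ F prefix-γ) ⟩
          value F C γ ⊗ (value F C β ⊗ prefix (containers g)) ≈⟨ ⊗-assoc _ _ _ ⟨
          (value F C γ ⊗ value F C β) ⊗ prefix (containers g) ≈⟨ ⊗-cong (≋-trans (⊗-comm _ _) (≋-sym (value≋ p))) ≋-refl ⟩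
          vertexValue (suc g)                                 ∎
          where
          p = product eq
          γ<g = proj₁ (edge-< F C (edgeʳ p))
          -- The factor `β`, absent from the constant edges, appears here: the stack of `γ` is `g`
          -- on top of the stack of `g`.
          prefix-γ : prefix (containers γ) ≡ value F C β ⊗ prefix (containers g)
          prefix-γ = trans (cong prefix (containers-γ eq)) (cong (λ i → value F C (left i) ⊗ prefix (containers g)) eq)
          prefixDegree-γ : prefixDegree (containers γ) ≡ degree F C β + prefixDegree (containers g)
          prefixDegree-γ = trans (cong prefixDegree (containers-γ eq))
            (cong (λ i → degree F C (left i) + prefixDegree (containers g)) eq)
          deg : vertexDegree (suc γ) ≤ suc k
          deg = ≤-trans (≤-reflexive (trans (cong (degree F C γ +_) prefixDegree-γ)
            (trans (sym (+-assoc (degree F C γ) _ _))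
              (cong (_+ prefixDegree (containers g)) (trans (+-comm (degree F C γ) _) (sym (degree≡ p))))))) d≤

    iterate-correct : ∀ k → Correct k (iterate k step initial)
    iterate-correct zero    = initial-correct
    iterate-correct (suc k) = step-correct (iterate-correct k)

    iterate-output : ∀ {m k} → t ≡ suc m → degree F C m ≤ k → _≋_ F (iterate k step initial t) (value F C m)
    iterate-output {m} {k} refl d≤k = ≋-trans (iterate-correct k (suc m) ≤-refl
        (subst (λ αs → degree F C m + prefixDegree αs ≤ k) (sym none) (subst (_≤ k) (sym (+-identityʳ _)) d≤k)))
      (≋-trans (≡⇒≋ F (cong (λ αs → value F C m ⊗ prefix αs) none)) (⊗-idʳ F _))
      where none = containers-last refl

-- Numerical bounds

square-cancel-≤ : ∀ {m n} → m * m ≤ n * n → m ≤ n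
square-cancel-≤ {m} {n} m²≤n² with m ≤? n
... | yes m≤n = m≤n
... | no m≰n  = contradiction m²≤n² (<⇒≱ (*-mono-< (≰⇒> m≰n) (≰⇒> m≰n)))

isqrt : ∀ n → ∃[ a ] (a * a ≤ n × n < suc a * suc a)
isqrt zero    = 0 , z≤n , s≤s z≤n
isqrt (suc n) with isqrt n
... | a , a²≤n , n<a⁺² with suc a * suc a ≤? suc n
... | yes le = suc a , le , <-≤-trans (s≤s n<a⁺²) (*-mono-< (n<1+n (suc a)) (n<1+n (suc a)))
... | no nle = a , m≤n⇒m≤1+n a²≤n , ≰⇒> nle

halve : ∀ a → ∃[ h ] (a ≡ h + h ⊎ suc a ≡ h + h)
halve zero          = 0 , inj₁ refl
halve (suc zero)    = 1 , inj₂ refl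
halve (suc (suc a)) with halve a
... | h , inj₁ eq = suc h , inj₁ (cong suc (trans (cong suc eq) (sym (+-suc h h))))
... | h , inj₂ eq = suc h , inj₂ (cong suc (trans (cong suc eq) (sym (+-suc h h))))

private
  3d≤a²+2a : ∀ {d a} → 3 * d < suc a * suc a → 3 * d ≤ a * a + 2 * a
  3d≤a²+2a {d} {a} lt = ≤-pred (≤-trans lt (≤-reflexive (expand a)))
    where
    expand : ∀ a → suc a * suc a ≡ suc (a * a + 2 * a)
    expand = solve-∀

  a≤a² : ∀ a → a ≤ a * a
  a≤a² zero    = z≤n
  a≤a² (suc a) = m≤m*n (suc a) (suc a)

-- With a = ⌊√(3d)⌋, a blocks of 2⌈a/2⌉ edges leave room for d input edges.
enough-steps : ∀ d a h → 3 * d < suc a * suc a → a ≡ h + h ⊎ suc a ≡ h + h → d ≤ a * h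
enough-steps d a zero          lt (inj₁ refl) = *-cancelˡ-≤ 3 (3d≤a²+2a {d} {0} lt)
enough-steps d a (suc zero)    lt (inj₁ refl) = ≤-pred (*-cancelˡ-< 3 d 3 lt)
-- For even `a` the product of the two block parameters is a²/2, and 2(a² + 2a) ≤ 3a² needs a ≥ 4;
-- hence the separate cases 0 and 2. The added term is the slack a(a - 4) for a = 2h + 4.
enough-steps d a (suc (suc h)) lt (inj₁ refl) = *-cancelˡ-≤ 6 (begin
  6 * d                                       ≡⟨ *-assoc 2 3 d ⟩
  2 * (3 * d)                                 ≤⟨ *-monoʳ-≤ 2 (3d≤a²+2a {d} {a} lt) ⟩
  2 * (a * a + 2 * a)                         ≤⟨ m≤m+n _ (4 * (h * h) + 8 * h) ⟩
  2 * (a * a + 2 * a) + (4 * (h * h) + 8 * h) ≡⟨ identity h ⟩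
  6 * (a * suc (suc h))                       ∎)
  where
  open ≤-Reasoning
  identity : ∀ h → 2 * ((suc (suc h) + suc (suc h)) * (suc (suc h) + suc (suc h)) + 2 * (suc (suc h) + suc (suc h)))
    + (4 * (h * h) + 8 * h) ≡ 6 * ((suc (suc h) + suc (suc h)) * suc (suc h))
  identity = solve-∀
enough-steps d a h             lt (inj₂ eq)   = *-cancelˡ-≤ 6 (begin
  6 * d                         ≡⟨ *-assoc 2 3 d ⟩
  2 * (3 * d)                   ≤⟨ *-monoʳ-≤ 2 (3d≤a²+2a {d} {a} lt) ⟩
  2 * (a * a + 2 * a)           ≡⟨ lhs a ⟩
  2 * (a * a) + 3 * a + a       ≤⟨ +-monoʳ-≤ (2 * (a * a) + 3 * a) (a≤a² a) ⟩
  2 * (a * a) + 3 * a + a * a   ≡⟨ rhs a ⟩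
  3 * (a * suc a)               ≡⟨ cong (λ z → 3 * (a * z)) eq ⟩
  3 * (a * (h + h))             ≡⟨ double a h ⟩
  6 * (a * h)                   ∎)
  where
  open ≤-Reasoning
  lhs : ∀ a → 2 * (a * a + 2 * a) ≡ 2 * (a * a) + 3 * a + a
  lhs = solve-∀
  rhs : ∀ a → 2 * (a * a) + 3 * a + a * a ≡ 3 * (a * suc a)
  rhs = solve-∀
  double : ∀ a h → 3 * (a * (h + h)) ≡ 6 * (a * h)
  double = solve-∀

-- Lets the number of blocks be absorbed into one more power of t + 1 in the counts for the formula.
sqrt≤size : ∀ {a d t} → a * a ≤ 3 * d → d ≤ t → a ≤ suc t
sqrt≤size {a} {d} {t} a²≤3d d≤t = square-cancel-≤ (begin
  a * a                  ≤⟨ a²≤3d ⟩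
  3 * d                  ≤⟨ *-monoʳ-≤ 3 d≤t ⟩
  3 * t                  ≡⟨ lhs t ⟩
  t + 2 * t              ≤⟨ +-monoˡ-≤ (2 * t) (a≤a² t) ⟩
  t * t + 2 * t          ≤⟨ n≤1+n _ ⟩
  suc (t * t + 2 * t)    ≡⟨ rhs t ⟩
  suc t * suc t          ∎)
  where
  open ≤-Reasoning
  lhs : ∀ t → 3 * t ≡ t + 2 * t
  lhs = solve-∀
  rhs : ∀ t → suc (t * t + 2 * t) ≡ suc t * suc t
  rhs = solve-∀

^-distribʳ-* : ∀ q m n → (m * n) ^ q ≡ m ^ q * n ^ q
^-distribʳ-* zero    m n = refl
^-distribʳ-* (suc q) m n = trans (cong (m * n *_) (^-distribʳ-* q m n)) (interchange m n (m ^ q) (n ^ q))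
  where
  interchange : ∀ a b c d → a * b * (c * d) ≡ a * c * (b * d)
  interchange = solve-∀

-- An integer `r` below √m is enough: `r * r ≤ m` and `m * (q * q) ≤ p * p` give `r * q ≤ p`, so a
-- bound with `r` in the exponent passes to every rational upper bound p/q of √m.
powBound : ∀ b n s e m {N} r .{{_ : NonZero n}} → r * r ≤ m → N ≤ b * n ^ (s * r + e) → PowBound b n s e m N
powBound b n s e m {N} r r²≤m N≤ p q _ mq²≤p² = begin
  N ^ q                            ≤⟨ ^-monoˡ-≤ q N≤ ⟩
  (b * n ^ (s * r + e)) ^ q        ≡⟨ ^-distribʳ-* q b _ ⟩
  b ^ q * (n ^ (s * r + e)) ^ q    ≡⟨ cong (b ^ q *_) (^-*-assoc n (s * r + e) q) ⟩
  b ^ q * n ^ ((s * r + e) * q)    ≤⟨ *-monoʳ-≤ (b ^ q) (^-monoʳ-≤ n exponent) ⟩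
  b ^ q * n ^ (s * p + e * q)      ∎
  where
  open ≤-Reasoning
  square-* : ∀ r q → (r * q) * (r * q) ≡ (r * r) * (q * q)
  square-* = solve-∀
  rq≤p : r * q ≤ p
  rq≤p = square-cancel-≤ (≤-trans (≤-reflexive (square-* r q)) (≤-trans (*-monoˡ-≤ (q * q) r²≤m) mq²≤p²))
  exponent : (s * r + e) * q ≤ s * p + e * q
  exponent = begin
    (s * r + e) * q       ≡⟨ *-distribʳ-+ q (s * r) e ⟩
    s * r * q + e * q     ≡⟨ cong (_+ e * q) (*-assoc s r q) ⟩
    s * (r * q) + e * q   ≤⟨ +-monoˡ-≤ (e * q) (*-monoʳ-≤ s rq≤p) ⟩
    s * p + e * q         ∎

-- Integer constants of bounded absolute value

module _ {c ℓ : Level} (F : Field c ℓ) where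
  open Field F using (commutativeRing)
  open CommutativeRing commutativeRing using (_≈_; 0#; 1#; ring; setoid)
    renaming (Carrier to K; _+_ to _+K_; _*_ to _*K_; -_ to -K_)
  private
    module R = CommutativeRing commutativeRing
    module RP = RingProperties ring

  Small : ℕ → K → Set ℓ
  Small n a = ∃[ z ] (z ≤ n × (a ≈ ι F z ⊎ a ≈ -K ι F z))

  ι-+ : ∀ m n → ι F (m + n) ≈ ι F m +K ι F n
  ι-+ zero    n = R.sym (R.+-identityˡ _)
  ι-+ (suc m) n = R.trans (R.+-congˡ (ι-+ m n)) (R.sym (R.+-assoc _ _ _))

  ι-∸ : ∀ {m n} → n ≤ m → ι F m +K -K ι F n ≈ ι F (m ∸ n)
  ι-∸ {m} {n} n≤m = begin
    ι F m +K -K ι F n                        ≈⟨ R.+-congʳ (R.reflexive (cong (ι F) (m∸n+n≡m n≤m))) ⟨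
    ι F (m ∸ n + n) +K -K ι F n              ≈⟨ R.+-congʳ (ι-+ (m ∸ n) n) ⟩
    (ι F (m ∸ n) +K ι F n) +K -K ι F n       ≈⟨ R.+-assoc _ _ _ ⟩
    ι F (m ∸ n) +K (ι F n +K -K ι F n)       ≈⟨ R.+-congˡ (R.-‿inverseʳ _) ⟩
    ι F (m ∸ n) +K 0#                        ≈⟨ R.+-identityʳ _ ⟩
    ι F (m ∸ n)                              ∎
    where open SetoidReasoning setoid

  Small-≈ : ∀ {n a b} → a ≈ b → Small n a → Small n b
  Small-≈ a≈b (z , z≤ , inj₁ e) = z , z≤ , inj₁ (R.trans (R.sym a≈b) e)
  Small-≈ a≈b (z , z≤ , inj₂ e) = z , z≤ , inj₂ (R.trans (R.sym a≈b) e)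

  Small-mono : ∀ {m n a} → m ≤ n → Small m a → Small n a
  Small-mono m≤n (z , z≤m , e) = z , ≤-trans z≤m m≤n , e

  Small-0 : ∀ {n} → Small n 0#
  Small-0 = 0 , z≤n , inj₁ R.refl

  Small-1 : ∀ {n} → Small (suc n) 1#
  Small-1 = 1 , s≤s z≤n , inj₁ (R.sym (R.+-identityʳ 1#))

  Small-neg : ∀ {n a} → Small n a → Small n (-K a)
  Small-neg (z , z≤ , inj₁ e) = z , z≤ , inj₂ (R.-‿cong e)
  Small-neg (z , z≤ , inj₂ e) = z , z≤ , inj₁ (R.trans (R.-‿cong e) (RP.-‿involutive _))

  -- Summands of opposite sign: the smaller absolute value is subtracted from the larger, so no
  -- signed integers are needed.
  Small-difference : ∀ {m n} x y → x ≤ m → y ≤ n → Small (m + n) (ι F x +K -K ι F y)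
  Small-difference {m} {n} x y x≤m y≤n with ≤-total y x
  ... | inj₁ y≤x = x ∸ y , ≤-trans (m∸n≤m x y) (≤-trans x≤m (m≤m+n m n)) , inj₁ (ι-∸ y≤x)
  ... | inj₂ x≤y = y ∸ x , ≤-trans (m∸n≤m y x) (≤-trans y≤n (m≤n+m n m)) , inj₂ (begin
    ι F x +K -K ι F y          ≈⟨ R.+-comm _ _ ⟩
    -K ι F y +K ι F x          ≈⟨ R.+-congˡ (RP.-‿involutive _) ⟨
    -K ι F y +K -K (-K ι F x)  ≈⟨ RP.-‿+-comm _ _ ⟩
    -K (ι F y +K -K ι F x)     ≈⟨ R.-‿cong (ι-∸ x≤y) ⟩
    -K ι F (y ∸ x)             ∎)
    where open SetoidReasoning setoid

  Small-+ : ∀ {m n a b} → Small m a → Small n b → Small (m + n) (a +K b)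
  Small-+ (x , x≤ , inj₁ e) (y , y≤ , inj₁ f) =
    x + y , +-mono-≤ x≤ y≤ , inj₁ (R.trans (R.+-cong e f) (R.sym (ι-+ x y)))
  Small-+ (x , x≤ , inj₁ e) (y , y≤ , inj₂ f) =
    Small-≈ (R.sym (R.+-cong e f)) (Small-difference x y x≤ y≤)
  Small-+ {m} {n} (x , x≤ , inj₂ e) (y , y≤ , inj₁ f) =
    Small-≈ (R.trans (R.+-comm _ _) (R.sym (R.+-cong e f)))
      (subst (λ k → Small k (ι F y +K -K ι F x)) (+-comm n m) (Small-difference y x y≤ x≤))
  Small-+ (x , x≤ , inj₂ e) (y , y≤ , inj₂ f) =
    x + y , +-mono-≤ x≤ y≤ , inj₂ (R.trans (R.+-cong e f)
      (R.trans (RP.-‿+-comm _ _) (R.-‿cong (R.sym (ι-+ x y)))))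

  Small-*-unit : ∀ {n w a} → w ≈ 1# ⊎ w ≈ -K 1# → Small n a → Small n (w *K a)
  Small-*-unit (inj₁ e) s = Small-≈ (R.sym (R.trans (R.*-congʳ e) (R.*-identityˡ _))) s
  Small-*-unit (inj₂ e) s = Small-≈ (R.sym (R.trans (R.*-congʳ e) (RP.-1*x≈-x _))) (Small-neg s)

  module BranchingProgramInputs {t} (C : Circuit F t) (weakly-skew : WeaklySkew F C) where
    open WeaklySkewCircuit F C weakly-skew
    open BranchingProgram F C weakly-skew

    -- The bound on constants is conditional, so that the same construction covers arbitrary
    -- constants and weights.
    data Allowed : Input F → Set (c ⊔ ℓ) where
      from-circuit : ∀ {x k} → GateAt F C k (var x) → Allowed (indeterminate x)
      small        : ∀ {a} → (ConstantFree F C → OrdinaryAdds F C → Small (2 ^ t) a) → Allowed (constant a)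

    δ-small : ∀ {n} u v → Small (suc n) (δ u v)
    δ-small u v with does (u ≟ v)
    ... | true  = Small-1
    ... | false = Small-0

    -- This is 2^f - 1: the empty walk contributes at most 1, and a gate has at most two incoming
    -- constant edges, of weight 1 or -1. The final `+ 0` matches the end of the `foldr` in
    -- `closure`.
    walkBound : ℕ → ℕ
    walkBound zero    = 0
    walkBound (suc f) = 1 + (walkBound f + (walkBound f + 0))

    1+walkBound : ∀ f → suc (walkBound f) ≡ 2 ^ f
    1+walkBound zero    = refl
    1+walkBound (suc f) = trans (double (walkBound f)) (cong (2 *_) (1+walkBound f))
      where
      double : ∀ b → suc (1 + (b + (b + 0))) ≡ 2 * suc b
      double = solve-∀

    closure-small : OrdinaryAdds F C → ∀ f v g → Small (walkBound f) (closure f v g)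
    closure-small ord zero    v g = Small-0
    closure-small ord (suc f) v g = Small-+ {m = 1} (δ-small v (suc g)) (weighted (spec g))
      where
      B = walkBound f
      weighted : ∀ {i} → Spec g i →
        Small (B + (B + 0)) (foldr (λ (w , i) acc → (w *K closure f v i) +K acc) 0# (constantEdges i))
      weighted (inpS _) = Small-0
      weighted (outS _) = Small-0
      weighted (prdS {γ = γ} _) = Small-+ (Small-*-unit (inj₁ R.refl) (closure-small ord f v γ)) Small-0
      weighted (linS p) with ord g _ p
      ... | w₁ , w₂ , i , j , refl , e₁ , e₂ =
        Small-+ (Small-*-unit (inj₁ e₁) (closure-small ord f v (toℕ i)))
          (Small-+ (Small-*-unit e₂ (closure-small ord f v (toℕ j))) Small-0)

    δ-allowed : ∀ u v → Allowed (constant (δ u v))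
    δ-allowed u v = small λ _ _ → subst (λ n → Small n (δ u v)) (1+walkBound t) (δ-small u v)

    inputGate-allowed : ∀ {k} x → GateAt F C k (inputGate F x) → Allowed x
    inputGate-allowed (indeterminate x) p = from-circuit p
    inputGate-allowed {k} (constant a) p = small λ free _ → subst (λ n → Small n a) (1+walkBound t) (cases (free k a p))
      where
      cases : ∀ {n} → a ≈ 0# ⊎ a ≈ 1# ⊎ a ≈ -K 1# → Small (suc n) a
      cases (inj₁ e)        = Small-≈ (R.sym e) Small-0
      cases (inj₂ (inj₁ e)) = Small-≈ (R.sym e) Small-1
      cases (inj₂ (inj₂ e)) = Small-≈ (R.sym e) (Small-neg Small-1)

    inputStep-allowed : ∀ u v → Allowed (inputStep u v)
    inputStep-allowed u zero    = δ-allowed u 0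
    inputStep-allowed u (suc g) = entry (spec g)
      where
      entry : ∀ {i s} → Spec g i → Allowed (inputEntry i u s)
      entry {s = s} (inpS {x} p) with does (u ≟ s)
      ... | true  = inputGate-allowed x p
      ... | false = small λ _ _ → Small-0
      entry (linS _) = small λ _ _ → Small-0
      entry (prdS _) = small λ _ _ → Small-0
      entry (outS _) = small λ _ _ → Small-0

    constantStep-allowed : ∀ u v → Allowed (constantStep u v)
    constantStep-allowed u zero    = δ-allowed u 0
    constantStep-allowed u (suc g) = small λ _ ord →
      Small-mono (≤-trans (n≤1+n _) (≤-reflexive (1+walkBound t))) (closure-small ord t u g)

-- Cutting walks into blocks

iterate-+ : ∀ {a} {A : Set a} j k (f : A → A) x → iterate (j + k) f x ≡ iterate j f (iterate k f x)
iterate-+ zero    k f x = refl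
iterate-+ (suc j) k f x = cong f (iterate-+ j k f x)

iterate-comm : ∀ {a} {A : Set a} k (f : A → A) x → iterate k f (f x) ≡ f (iterate k f x)
iterate-comm zero    f x = refl
iterate-comm (suc k) f x = cong f (iterate-comm k f x)

length-cartesianProduct : ∀ {a b} {A : Set a} {B : Set b} (xs : List A) (ys : List B) →
  length (cartesianProduct xs ys) ≡ length xs * length ys
length-cartesianProduct []       ys = refl
length-cartesianProduct (x ∷ xs) ys = trans (length-++ (map (x ,_) ys))
  (cong₂ _+_ (length-map (x ,_) ys) (length-cartesianProduct xs ys))

count-∉ : ∀ {i js} → i ∉ js → count i js ≡ 0
count-∉ {i} {js} i∉ = cong length (filter-none (_≟ i) {xs = js} (All.tabulate λ { j∈ refl → i∉ j∈ }))

module _ {c ℓ : Level} (F : Field c ℓ) where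
  open Field F using (commutativeRing)
  open CommutativeRing commutativeRing using (0#; 1#)

  acts-cong : ∀ {e} {E : Set e} (⟦_⟧ : E → Expr F) V A As {y z} → (∀ u → _≋_ F (y u) (z u)) →
    ∀ v → _≋_ F (acts F ⟦_⟧ V y A As v) (acts F ⟦_⟧ V z A As v)
  acts-cong ⟦_⟧ V A []       h v = ∑-cong F V λ u → ⊗-cong (h u) ≋-refl
  acts-cong ⟦_⟧ V A (B ∷ As) h = acts-cong ⟦_⟧ V B As λ v → ∑-cong F V λ u → ⊗-cong (h u) ≋-refl

  module Simulation {m} (C : Circuit F (suc m)) (weakly-skew : WeaklySkew F C) where
    open BranchingProgram F C weakly-skew
    open BranchingProgramInputs F C weakly-skew
    d = formalDegree F C
    open Builder F (3 * d) Allowed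
    open State
    open Built
    open Plan
    open _⊑_

    t n : ℕ
    t = suc m
    n = suc t

    simulation : ∀ (S : State) {rs} (rs< : All (_< gateCount S) rs) (rs-layer : All (λ r → layer S r ≡ 3) rs) →
      (∀ {i} → i < gateCount S → layer S i ≡ 0 → fanout F (circuit S) i + count i rs ≤ 1) →
      _≋_ F (∑ F rs (value F (circuit S))) (output F C) →
      Depth4Simulation F C (Finish.Γ S rs rs< rs-layer)
    simulation S rs< rs-layer fan≤1 out =
      well-formed (λ i< l≡0 → ≤-trans (≤-reflexive (fanout-Γ _)) (fan≤1 i< l≡0)) , depth-four , unweighted ,
      ≋-trans output-Γ out , mul-fan-in , variables , λ free ord k a p → constants free ord (constants-allowed k a p)
      where
      open Finish S _ rs< rs-layer
      variables : InputsFrom F Γ C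
      variables k x p with variables-allowed k x p
      ... | from-circuit q = _ , q
      constants : ∀ {a} → ConstantFree F C → OrdinaryAdds F C → Allowed (constant a) → Small F (2 ^ t) a
      constants free ord (small s) = s free ord

    fromEmpty : ∀ {L ps nm na} → Plan emptyState L ps (λ _ → ⊤) nm na → Built emptyState L ps (λ _ → ⊤) nm na
    fromEmpty P = run P emptyState ⊑-refl

    -- Starting from nothing, each gate either has exactly one outgoing edge or is exactly once a
    -- root.
    fanout-fromEmpty : ∀ {L ps nm na} (B : Built emptyState L ps (λ _ → ⊤) nm na) i →
      fanout F (circuit (result B)) i + count i (roots B) ≡ below i (gateCount (result B))
    fanout-fromEmpty B i = trans (sym (+-identityʳ _)) (fan B i tt)

    -- Together with the leading `inputStep`, which `walks` takes separately, these are `suc h`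
    -- rounds, that is 2h + 2 edges.
    blockTail : ℕ → List (ℕ → ℕ → Input F)
    blockTail zero    = constantStep ∷ []
    blockTail (suc h) = constantStep ∷ inputStep ∷ blockTail h

    length-blockTail : ∀ h → length (blockTail h) ≡ suc (h + h)
    length-blockTail zero    = refl
    length-blockTail (suc h) = cong suc (trans (cong suc (length-blockTail h)) (cong suc (sym (+-suc h h))))

    blockTail-allowed : ∀ h → All (λ A → ∀ {u v} → u ∈ V → v ∈ V → Allowed (A u v)) (blockTail h)
    blockTail-allowed zero    = (λ {u} {v} _ _ → constantStep-allowed u v) ∷ []
    blockTail-allowed (suc h) =
      (λ {u} {v} _ _ → constantStep-allowed u v) ∷ (λ {u} {v} _ _ → inputStep-allowed u v) ∷ blockTail-allowed h

    acts-block : ∀ h y → acts F (⟦_⟧ᵢ F) V y inputStep (blockTail h) ≡ iterate (suc h) step y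
    acts-block zero    y = refl
    acts-block (suc h) y = trans (acts-block h (step y)) (iterate-comm (suc h) step y)

    length-V : length V ≡ n
    length-V = length-upTo n

    -- Both parameters are shifted by one: there are `suc a` blocks of `suc h` rounds. Top products
    -- have fan-in a + 1 and block monomials 2h + 2, and the fan-in bound concerns the squares of
    -- these numbers minus one.
    module Expansion (a h : ℕ) (enough : d ≤ suc a * suc h)
      (top-fan-in : a ^ 2 ≤ 3 * d) (block-fan-in : suc (h + h) ^ 2 ≤ 3 * d) where

      N T : ℕ
      N = n ^ suc (h + h)
      T = n ^ a

      blockWalks : ℕ × ℕ → List (List (Input F))
      blockWalks (u , v) = walks V inputStep (blockTail h) u v

      block : ℕ × ℕ → Expr F
      block e = sumOfProducts F (⟦_⟧ᵢ F) (blockWalks e)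

      topTail : ℕ → List (ℕ → ℕ → ℕ × ℕ)
      topTail k = replicate k _,_

      topWalks : List (List (ℕ × ℕ))
      topWalks = walks V _,_ (topTail a) 0 t

      act-block : ∀ y v → _≋_ F (act F block V y _,_ v) (iterate (suc h) step y v)
      act-block y v = ≋-trans (∑-⊗-walks F (⟦_⟧ᵢ F) V y inputStep (blockTail h) v)
        (≡⇒≋ F (cong (λ f → f v) (acts-block h y)))

      acts-top : ∀ k y v → _≋_ F (acts F block V y _,_ (topTail k) v) (iterate (suc k * suc h) step y v)
      acts-top zero    y v = ≋-trans (act-block y v)
        (≡⇒≋ F (cong (λ j → iterate j step y v) (sym (*-identityˡ (suc h)))))
      acts-top (suc k) y v = ≋-trans (acts-cong block V _,_ (topTail k) (act-block y) v)
        (≋-trans (acts-top k _ v) (≡⇒≋ F (cong (λ f → f v)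
          (trans (sym (iterate-+ (suc k * suc h) (suc h) step y))
            (cong (λ j → iterate j step y) (+-comm (suc k * suc h) (suc h)))))))

      expansion : _≋_ F (sumOfProducts F block topWalks) (output F C)
      expansion = begin
        sumOfProducts F block topWalks             ≈⟨ ⊗-idˡ _ ⟨
        -- `initial` is the indicator of the source, so the sum over all starting vertices keeps
        -- only the walks from vertex 0.
        con 1# ⊗ sumOfProducts F block topWalks    ≈⟨ ∑-single F (Unique.upTo⁺ n) (∈-upTo⁺ (s≤s z≤n)) vanish ⟨
        ∑ F V (λ u → initial u ⊗ sumOfProducts F block (walks V _,_ (topTail a) u t))
                                                   ≈⟨ ∑-⊗-walks F block V initial _,_ (topTail a) t ⟩
        acts F block V initial _,_ (topTail a) t   ≈⟨ acts-top a initial t ⟩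
        iterate (suc a * suc h) step initial t     ≈⟨ iterate-output refl (subst (_≤ suc a * suc h) (formalDegree≡degree F C) enough) ⟩
        value F C m                                ≡⟨ output≡value F C ⟨
        output F C                                 ∎
        where
        open SetoidReasoning (≋-setoid F)
        vanish : ∀ {u} → u ≢ 0 → _≋_ F (initial u ⊗ sumOfProducts F block (walks V _,_ (topTail a) u t)) (con 0#)
        vanish {zero}  u≢0 = contradiction refl u≢0
        vanish {suc u} u≢0 = ⊗-zeroˡ _

      InV : ℕ × ℕ → Set
      InV (u , v) = u ∈ V × v ∈ V

      length-topWalks : length topWalks ≡ T
      length-topWalks = trans (length-walks V _,_ (topTail a) 0 t) (cong₂ _^_ length-V (length-replicate a))

      topWalks-ok : All (λ ms → length ms ≡ suc a × All InV ms) topWalks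
      topWalks-ok = All.map (λ (eq , ok) → trans eq (cong suc (length-replicate a)) , ok)
        (All-walks V _,_ (topTail a) (_,_ ∷ All.replicate⁺ a _,_) (∈-upTo⁺ (s≤s z≤n)) (∈-upTo⁺ ≤-refl))

      edgePlan : ∀ {Base Q} e → InV e → Plan Base 2 (block e ∷ []) Q N 1
      edgePlan e@(u , v) (u∈ , v∈) = replan refl
        (trans (length-walks V inputStep (blockTail h) u v) (cong₂ _^_ length-V (length-blockTail h))) refl
        (blockPlan (blockWalks e) (All.map (λ (eq , ok) →
          subst (λ k → (k ∸ 1) ^ 2 ≤ 3 * d) (sym (trans eq (cong suc (length-blockTail h)))) block-fan-in , ok)
          (All-walks V inputStep (blockTail h) ((λ {u} {v} _ _ → inputStep-allowed u v) ∷ blockTail-allowed h) u∈ v∈)))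

      productPlan : ∀ {Base Q nm na} ms → length ms ≡ suc a → Plan Base 2 (map block ms) Q nm na →
        Plan Base 3 (∏ F ms block ∷ []) Q (nm + 1) na
      productPlan ms eq P = replan (∏-map F block ms _) refl (+-identityʳ _)
        (mulPlan refl ≤-refl (subst (λ k → (k ∸ 1) ^ 2 ≤ 3 * d) (sym (trans (length-map block ms) eq)) top-fan-in) P)

      sum-of-roots : ∀ {S Q nm na} (B : Built S 3 (map (λ ms → ∏ F ms block) topWalks) Q nm na) →
        _≋_ F (∑ F (roots B) (value F (circuit (result B)))) (output F C)
      sum-of-roots B = ≋-trans (∑-Pointwise (roots-value B))
        (≋-trans (≡⇒≋ F (∑-map F (λ ms → ∏ F ms block) topWalks _)) expansion)

      TopBuilt : State → (ℕ → Set) → ℕ → ℕ → Set (c ⊔ ℓ)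
      TopBuilt S Q = Built S 3 (map (λ ms → ∏ F ms block) topWalks) Q

      finishFormula : ∀ {nm na} → TopBuilt emptyState (λ _ → ⊤) nm na →
        Σ ℕ λ k → Σ (Circuit F (suc k)) λ Γ → Depth4Simulation F C Γ × IsFormula F Γ ×
          countAdd F Γ ≡ suc na × countMul F Γ ≡ nm
      finishFormula B = _ , Γ , simulation (result B) (roots< B) (roots-layer B)
            (λ {i} _ _ → ≤-trans (≤-reflexive (fanout-fromEmpty B i)) (below≤1 i (gateCount (result B)))) (sum-of-roots B)
        , is-formula (λ {i} i< → trans (fanout-Γ i) (trans (fanout-fromEmpty B i) (below-< i<)))
        , cong suc (adds B) , muls B
        where open Finish (result B) (roots B) (roots< B) (roots-layer B)

      -- Nothing is shared: each of the `T` products builds its own `suc a` blocks, with `N`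
      -- monomials in each.
      formulaPlan : Plan emptyState 3 (map (λ ms → ∏ F ms block) topWalks) (λ _ → ⊤)
        (length topWalks * (suc a * N + 1)) (length topWalks * suc a)
      formulaPlan = forestPlan (λ ms → ∏ F ms block) (suc a * N + 1) (suc a) topWalks
        (All.map (λ {ms} (eq , ok) → replan refl (cong (λ k → k * N + 1) eq) (trans (*-identityʳ _) eq)
          (productPlan ms eq (forestPlan block N 1 ms (All.map (edgePlan _) ok)))) topWalks-ok)

      formula : Σ ℕ λ k → Σ (Circuit F (suc k)) λ Γ → Depth4Simulation F C Γ × IsFormula F Γ ×
        countAdd F Γ ≡ suc (T * suc a) × countMul F Γ ≡ T * (suc a * N + 1)
      formula =
        let k , Γ , sim , form , adds≡ , muls≡ = finishFormula (fromEmpty formulaPlan) in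
        k , Γ , sim , form , trans adds≡ (cong (λ l → suc (l * suc a)) length-topWalks)
          , trans muls≡ (cong (_* (suc a * N + 1)) length-topWalks)

      edgePairs : List (ℕ × ℕ)
      edgePairs = cartesianProduct V V

      length-edgePairs : length edgePairs ≡ n * n
      length-edgePairs = trans (length-cartesianProduct V V) (cong₂ _*_ length-V length-V)

      -- The blocks of all pairs of vertices are built beforehand, and the top products merely refer
      -- to them. Their sums, `roots B₁`, are the only gates that may have several outgoing edges.
      module Shared {nm₁ na₁} (B₁ : Built emptyState 2 (map block edgePairs) (λ _ → ⊤) nm₁ na₁) where
        S₁ : State
        S₁ = result B₁

        HasValue : ℕ → Expr F → Set (c ⊔ ℓ)
        HasValue r p = _≋_ F (value F (circuit S₁) r) p

        root : ∀ {e es rs} → e ∈ es → Pointwise HasValue rs (map block es) → ∃[ r ] (r ∈ rs × HasValue r (block e))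
        root (here refl) (x ∷ _)  = _ , here refl , x
        root (there e∈)  (_ ∷ xs) = let r , r∈ , v = root e∈ xs in r , there r∈ , v

        rootList : ∀ {ms} → All InV ms → ∃[ js ] (All (_∈ roots B₁) js × Pointwise HasValue js (map block ms))
        rootList []               = [] , [] , []
        rootList ((u∈ , v∈) ∷ ok) =
          let r , r∈ , v = root (∈-cartesianProduct⁺ u∈ v∈) (roots-value B₁)
              js , js∈ , vs = rootList ok
          in r ∷ js , r∈ ∷ js∈ , v ∷ vs

        sharedPlan : ∀ ms → All InV ms → Plan S₁ 2 (map block ms) (_∉ roots B₁) 0 0
        sharedPlan ms ok = let js , js∈ , vs = rootList ok in
          refsPlan (All.map (All.lookup (roots< B₁)) js∈) (All.map (All.lookup (roots-layer B₁)) js∈) vs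
            (λ i i∉ → count-∉ λ i∈ → i∉ (All.lookup js∈ i∈))

        topPlan : Plan S₁ 3 (map (λ ms → ∏ F ms block) topWalks) (_∉ roots B₁) (length topWalks * 1) (length topWalks * 0)
        topPlan = forestPlan (λ ms → ∏ F ms block) 1 0 topWalks
          (All.map (λ {ms} (eq , ok) → productPlan ms eq (sharedPlan ms ok)) topWalks-ok)

        finishShared : ∀ {nm₂ na₂} → TopBuilt S₁ (_∉ roots B₁) nm₂ na₂ →
          Σ ℕ λ k → Σ (Circuit F (suc k)) λ Γ → Depth4Simulation F C Γ ×
            countAdd F Γ ≡ suc (na₁ + na₂) × countMul F Γ ≡ nm₁ + nm₂
        finishShared {nm₂} {na₂} B₂ = _ , Γ , simulation (result B₂) (roots< B₂) (roots-layer B₂) fan≤1 (sum-of-roots B₂)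
          , cong suc (trans (adds B₂) (cong (_+ na₂) (adds B₁)))
          , trans (muls B₂) (cong (_+ nm₂) (muls B₁))
          where
          open Finish (result B₂) (roots B₂) (roots< B₂) (roots-layer B₂)
          fan≤1 : ∀ {i} → i < gateCount (result B₂) → layer (result B₂) i ≡ 0 →
            fanout F (circuit (result B₂)) i + count i (roots B₂) ≤ 1
          fan≤1 {i} _ l≡0 = ≤-trans (+-cancelʳ-≤ (below i (gateCount S₁)) _ _ (begin
            fanout F (circuit (result B₂)) i + count i (roots B₂) + below i (gateCount S₁)
              ≡⟨ fan B₂ i i∉ ⟩
            fanout F (circuit S₁) i + below i (gateCount (result B₂))
              ≤⟨ +-monoˡ-≤ (below i (gateCount (result B₂))) (≤-trans (m≤m+n _ _) (≤-reflexive (fanout-fromEmpty B₁ i))) ⟩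
            below i (gateCount S₁) + below i (gateCount (result B₂))
              ≡⟨ +-comm (below i (gateCount S₁)) _ ⟩
            below i (gateCount (result B₂)) + below i (gateCount S₁) ∎)) (below≤1 i (gateCount (result B₂)))
            where
            open ≤-Reasoning
            -- Shared gates are block sums, of layer 2, so the fan-out account still holds for the
            -- input gates, of layer 0.
            i∉ : i ∉ roots B₁
            i∉ i∈ = contradiction (trans (sym l≡0) (trans (layer≡ (extends B₂) (All.lookup (roots< B₁) i∈))
              (All.lookup (roots-layer B₁) i∈))) λ ()

        shared : Σ ℕ λ k → Σ (Circuit F (suc k)) λ Γ → Depth4Simulation F C Γ ×
          countAdd F Γ ≡ suc na₁ × countMul F Γ ≡ nm₁ + T
        shared =
          let k , Γ , sim , adds≡ , muls≡ = finishShared (run topPlan S₁ ⊑-refl) in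
          k , Γ , sim
            , trans adds≡ (cong suc (trans (cong (na₁ +_) (*-zeroʳ (length topWalks))) (+-identityʳ na₁)))
            , trans muls≡ (cong (nm₁ +_) (trans (*-identityʳ _) length-topWalks))

      edgesPlan : Plan emptyState 2 (map block edgePairs) (λ _ → ⊤) (length edgePairs * N) (length edgePairs * 1)
      edgesPlan = forestPlan block N 1 edgePairs (All.tabulate λ {e} e∈ → edgePlan e (∈-cartesianProduct⁻ V V e∈))

      circuit-with-sharing : Σ ℕ λ k → Σ (Circuit F (suc k)) λ Γ → Depth4Simulation F C Γ ×
        countAdd F Γ ≡ suc (n * n) × countMul F Γ ≡ n * n * N + T
      circuit-with-sharing =
        let k , Γ , sim , adds≡ , muls≡ = Shared.shared (fromEmpty edgesPlan) in
        k , Γ , sim , trans adds≡ (cong suc (trans (*-identityʳ _) length-edgePairs))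
          , trans muls≡ (cong (λ l → l * N + T) length-edgePairs)

-- Gate counts as powers of t + 1

module _ (n : ℕ) .{{_ : NonZero n}} where
  open ≤-Reasoning

  private
    1≤n^ : ∀ k → 1 ≤ n ^ k
    1≤n^ k = m^n>0 n k

  -- The `+ 2` in the exponent pays for the n² pairs of vertices. The top products are fewer than
  -- this bound allows, and the factor 2 covers them.
  shared-muls≤ : ∀ {a h} → h + h ≤ a → n * n * n ^ suc (h + h) + n ^ a ≤ 2 * n ^ (1 * suc a + 2)
  shared-muls≤ {a} {h} 2h≤a = begin
    n * n * n ^ suc (h + h) + n ^ a            ≡⟨ cong (_+ n ^ a) (*-assoc n n (n ^ suc (h + h))) ⟩
    n ^ (3 + (h + h)) + n ^ a                  ≤⟨ +-mono-≤ (^-monoʳ-≤ n (+-monoʳ-≤ 3 2h≤a)) (^-monoʳ-≤ n (m≤n+m a 3)) ⟩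
    n ^ (3 + a) + n ^ (3 + a)                  ≡⟨ cong (n ^ (3 + a) +_) (+-identityʳ _) ⟨
    2 * n ^ (3 + a)                            ≡⟨ cong (λ k → 2 * n ^ k) (exponent a) ⟩
    2 * n ^ (1 * suc a + 2)                    ∎
    where
    exponent : ∀ a → 3 + a ≡ 1 * suc a + 2
    exponent = solve-∀

  formula-adds≤ : ∀ {a} → suc a ≤ n → n ^ a * suc a ≤ 1 * n ^ (1 * suc a + 0)
  formula-adds≤ {a} a<n = begin
    n ^ a * suc a             ≤⟨ *-monoʳ-≤ (n ^ a) a<n ⟩
    n ^ a * n                 ≡⟨ *-comm (n ^ a) n ⟩
    n ^ suc a                 ≡⟨ cong (n ^_) (exponent a) ⟩
    n ^ (1 * suc a + 0)       ≡⟨ *-identityˡ _ ⟨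
    1 * n ^ (1 * suc a + 0)   ∎
    where
    exponent : ∀ a → suc a ≡ 1 * suc a + 0
    exponent = solve-∀

  -- `suc a ≤ n` turns the number of blocks into one more power of `n`; the gate of the top product,
  -- counted by `+ 1`, is generously bounded by a second copy of the main term.
  formula-muls≤ : ∀ {a h} → suc a ≤ n → h + h ≤ a →
    n ^ a * (suc a * n ^ suc (h + h) + 1) ≤ 2 * n ^ (2 * suc a + 0)
  formula-muls≤ {a} {h} a<n 2h≤a = begin
    n ^ a * (suc a * n ^ suc (h + h) + 1)      ≤⟨ *-monoʳ-≤ (n ^ a) (+-mono-≤ (*-mono-≤ a<n (^-monoʳ-≤ n (s≤s 2h≤a))) (1≤n^ (2 + a))) ⟩
    n ^ a * (n ^ (2 + a) + n ^ (2 + a))        ≡⟨ double (n ^ a) (n ^ (2 + a)) ⟩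
    2 * (n ^ a * n ^ (2 + a))                  ≡⟨ cong (2 *_) (^-distribˡ-+-* n a (2 + a)) ⟨
    2 * n ^ (a + (2 + a))                      ≡⟨ cong (λ k → 2 * n ^ k) (exponent a) ⟩
    2 * n ^ (2 * suc a + 0)                    ∎
    where
    double : ∀ x y → x * (y + y) ≡ 2 * (x * y)
    double = solve-∀
    exponent : ∀ a → a + (2 + a) ≡ 2 * suc a + 0
    exponent = solve-∀

square-≤ : ∀ {x a d} → x ≤ a → a * a ≤ d → x ^ 2 ≤ d
square-≤ {x} x≤a a²≤d = ≤-trans (≤-reflexive (cong (x *_) (*-identityʳ x))) (≤-trans (*-mono-≤ x≤a x≤a) a²≤d)

-- With `suc a` in the role of ⌊√(3d)⌋ and `suc h` of its half rounded up, a block monomial has 2h +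
-- 2 ≤ ⌊√(3d)⌋ + 1 factors, just within the allowed fan-in.
odd-half≤ : ∀ {a h} → suc a ≡ suc h + suc h ⊎ suc (suc a) ≡ suc h + suc h → suc (h + h) ≤ suc a × h + h ≤ a
odd-half≤ {a} {h} (inj₁ eq) with refl ← trans (suc-injective eq) (+-suc h h) = n≤1+n _ , n≤1+n _
odd-half≤ {a} {h} (inj₂ eq) with refl ← suc-injective (trans (suc-injective eq) (+-suc h h)) = ≤-refl , ≤-refl

-- The depth four circuit and the depth four formula

module _ {c ℓ : Level} (F : Field c ℓ) {m : ℕ} (C : Circuit F (suc m)) where
  -- The base is a parameter because the bounds are proved for `suc (suc m)` and then transported to
  -- `suc m + 1`.
  Conclusion : ℕ → Set (c ⊔ ℓ)
  Conclusion n =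
    (Σ ℕ λ k → Σ (Circuit F (suc k)) λ Γ → Depth4Simulation F C Γ ×
      countAdd F Γ ≤ n ^ 2 + 1 × PowBound 2 n 1 2 (3 * formalDegree F C) (countMul F Γ))
    ×
    (Σ ℕ λ k → Σ (Circuit F (suc k)) λ Γf → Depth4Simulation F C Γf × IsFormula F Γf ×
      PowBound 1 n 1 0 (3 * formalDegree F C) (countAdd F Γf ∸ 1) ×
      PowBound 2 n 2 0 (3 * formalDegree F C) (countMul F Γf))

  module _ (weakly-skew : WeaklySkew F C) where
    private
      d n : ℕ
      d = formalDegree F C
      n = suc (suc m)

    -- The expansion always has at least one block, whose monomials would violate a fan-in bound of
    -- 1. But degree zero forces the zero polynomial, which a single empty sum computes.
    zero-degree-case : d ≡ 0 → Conclusion n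
    zero-degree-case d≡0 =
        (0 , Γ , sim , m≤n+m 1 (n ^ 2) , powBound 2 n 1 2 (3 * d) 0 z≤n z≤n)
      , (0 , Γ , sim , is-formula (λ ()) , powBound 1 n 1 0 (3 * d) 0 z≤n z≤n , powBound 2 n 2 0 (3 * d) 0 z≤n z≤n)
      where
      open Simulation F C weakly-skew using (simulation)
      open Builder F (3 * d) (BranchingProgramInputs.Allowed F C weakly-skew)
      open Finish emptyState _ [] []
      sim : Depth4Simulation F C Γ
      sim = simulation emptyState [] [] (λ ()) (≋-sym (≋-trans (≡⇒≋ F (output≡value F C))
        (BranchingProgram.degree-zero F C weakly-skew m ≤-refl (trans (sym (formalDegree≡degree F C)) d≡0))))

    positive-degree-case : ∀ a h → suc a * suc a ≤ 3 * d → 3 * d < suc (suc a) * suc (suc a) →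
      suc a ≡ suc h + suc h ⊎ suc (suc a) ≡ suc h + suc h → Conclusion n
    positive-degree-case a h a²≤3d 3d< parity =
      let k₁ , Γ , sim₁ , adds₁ , muls₁ = circuit-with-sharing
          k₂ , Γf , sim₂ , form , adds₂ , muls₂ = formula
      in (k₁ , Γ , sim₁
           , ≤-reflexive (trans adds₁ (trans (+-comm 1 (n * n)) (cong (λ z → n * z + 1) (sym (*-identityʳ n)))))
           , powBound 2 n 1 2 _ (suc a) a²≤3d (≤-trans (≤-reflexive muls₁) (shared-muls≤ n {h = h} 2h≤a)))
       , (k₂ , Γf , sim₂ , form
           , powBound 1 n 1 0 _ (suc a) a²≤3d (≤-trans (≤-reflexive (cong (_∸ 1) adds₂)) (formula-adds≤ n a<n))
           , powBound 2 n 2 0 _ (suc a) a²≤3d (≤-trans (≤-reflexive muls₂) (formula-muls≤ n {h = h} a<n 2h≤a)))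
      where
      open Simulation.Expansion F C weakly-skew a h
        (enough-steps d (suc a) (suc h) 3d< parity)
        (square-≤ (n≤1+n a) a²≤3d) (square-≤ (proj₁ (odd-half≤ parity)) a²≤3d)
      2h≤a : h + h ≤ a
      2h≤a = proj₂ (odd-half≤ parity)
      a<n : suc a ≤ n
      a<n = sqrt≤size a²≤3d (subst (_≤ suc m) (sym (formalDegree≡degree F C))
        (BranchingProgram.degree≤size F C weakly-skew ≤-refl))

    conclusion : Conclusion n
    conclusion with d ≟ 0
    ... | yes d≡0 = zero-degree-case d≡0
    ... | no d≢0 with isqrt (3 * d)
    -- A positive degree gives ⌊√(3d)⌋ ≥ 1, so there is at least one block and its half rounded up
    -- is positive as well.
    ... | zero  , _ , 3d<1 = contradiction (n≤0⇒n≡0 (*-cancelˡ-≤ 3 (≤-pred 3d<1))) d≢0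
    ... | suc a , a²≤3d , 3d< with halve (suc a)
    ... | zero  , inj₁ ()
    ... | zero  , inj₂ ()
    ... | suc h , parity = positive-degree-case a h a²≤3d 3d< parity

theorem4 : ∀ {c ℓ : Level} (F : Field c ℓ) {m : ℕ} (C : Circuit F (suc m)) →
    WellFormed F C → WeaklySkew F C →
    (Σ ℕ λ n → Σ (Circuit F (suc n)) λ Γ →
    Depth4Simulation F C Γ ×
    countAdd F Γ ≤ (suc m + 1) ^ 2 + 1 ×
    PowBound 2 (suc m + 1) 1 2 (3 * formalDegree F C) (countMul F Γ))
    ×
    (Σ ℕ λ n → Σ (Circuit F (suc n)) λ Γf →
    Depth4Simulation F C Γf ×
    IsFormula F Γf ×
    PowBound 1 (suc m + 1) 1 0 (3 * formalDegree F C) (countAdd F Γf ∸ 1) ×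
    PowBound 2 (suc m + 1) 2 0 (3 * formalDegree F C) (countMul F Γf))
theorem4 F {m} C _ weakly-skew = subst (Conclusion F C) (+-comm 1 (suc m)) (conclusion F C weakly-skew)
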